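{- $\mathrm{STL}^*\le\mathrm{MTL}$ and $\mathrm{STL}^*\not\le\mathrm{MPL}$, where $\mathrm{STL}^*$ is Substructure Temporal Logic.
   Context: Trees. A tree $T$ is a subset of $\mathbb{N}^*$ (finite words over the naturals) with an element $\tau_0\in T$ (the root) such that every $\tau\in T$ has the form $\tau_0\cdot\tau'$ with $\tau'\in\mathbb{N}^*$, and whenever $\tau_0\cdot\tau\in T$ and $\tau'$ is a prefix of $\tau$, also $\tau_0\cdot\tau'\in T$. Elements of $T$ are nodes. A child of $\tau$ in $T$ is a node of $T$ of the form $\tau\cdot n$, $n\in\mathbb{N}$; a descendant of $\tau$ in $T$ is a node of $T$ of the form $\tau\cdot\tau'$, $\tau'\in\mathbb{N}^*$ (so $\tau$ is a descendant of itself). A subtree of $T$ is a subset of $T$ that is a tree (with any root). A path of $T$ is a subtree of $T$ each of whose nodes has at most one child in it. $T$ is non-blocking if every node has a child in $T$. For a finite set $AP$ of atomic propositions, a Kripke tree over $AP$ is a pair $(T,\mathrm{Lab})$ with $T$ a non-blocking tree and $\mathrm{Lab}:T\to 2^{AP}$. Subtrees of Kripke trees inherit the labelling. MTL and MPL. Formulas over $AP$: $\varphi ::= P_a(x)\mid x\le y\mid x\in X\mid \neg\varphi\mid\varphi\wedge\varphi\mid\exists x.\varphi\mid\exists^{\alpha}X.\varphi$, with $a\in AP$. First-order variables range over nodes of $T$; $P_a(x)$ holds iff $a\in\mathrm{Lab}(x)$; $x\le y$ holds iff $y$ is a descendant of $x$; $x\in X$ is membership. Second-order variables range over all subtrees of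 $T$ in MTL (monadic tree logic) and over all paths of $T$ in MPL (monadic path logic). The logics consist of their sentences. $\mathrm{STL}^*$. State formulas $\varphi$ and path formulas $\psi$ over $AP$: $\varphi ::= a\mid\neg\varphi\mid\varphi\wedge\varphi\mid\varphi\vee\varphi\mid\varphi\,\mathbb{U}_{\varphi}\,\varphi\mid\varphi\,\mathbb{R}_{\varphi}\,\varphi\mid\varphi\,\mathbb{S}_{\varphi}\,\varphi\mid\varphi\,\mathbb{B}_{\varphi}\,\varphi\mid\mathsf{E}\psi\mid\mathsf{A}\psi$; $\psi ::= \varphi\mid\neg\psi\mid\psi\wedge\psi\mid\psi\vee\psi\mid\mathsf{X}\psi\mid\psi\,\mathsf{U}\,\psi\mid\psi\,\mathsf{R}\,\psi$. Formulas of the logic are the state formulas. For a Kripke tree $\mathcal{T}$ and a node $w$, $\mathcal{T}_w$ is the tree of all descendants of $w$ in $\mathcal T$. For Kripke trees (hence non-blocking) $\mathcal{T},\mathcal{T}'$ and a set of nodes $W$, $\mathcal{T}'$ is a (strict) $W$-subtree of $\mathcal{T}$ if $\mathcal{T}'$ is a (strict) subtree of $\mathcal{T}$ with the same root and, for every node $w\in W$ of $\mathcal{T}'$, all children of $w$ in $\mathcal{T}$ belong to $\mathcal{T}'$; then $\mathcal{T}$ is a (strict) $W$-supertree of $\mathcal{T}'$. Satisfaction $\mathcal{T}\models_{\mathcal{T}^\star}\varphi$ is defined for $\mathcal{T}$ a Kripke subtree of a Kripke tree $\mathcal{T}^\star$ with the same root. Put $[\![\phi]\!]=\{w\in\mathcal{T}:\mathcal{T}_w\models_{\mathcal{T}^\star_w}\phi\}$,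 relative to the current $\mathcal{T},\mathcal{T}^\star$. Then: - $\mathcal{T}\models_{\mathcal{T}^\star}a$ iff $a$ labels the root; Boolean connectives are standard. - $\mathsf{E}\psi$ (resp. $\mathsf{A}\psi$) holds iff some (resp. every) infinite path of $\mathcal{T}$ from its root satisfies $\psi$ at position $0$, where path formulas have the usual CTL*/LTL semantics and a state formula $\varphi$ holds at position $i$ of a path $\pi$ iff $\mathcal{T}_{\pi(i)}\models_{\mathcal{T}^\star_{\pi(i)}}\varphi$. - $\mathcal{T}\models_{\mathcal{T}^\star}\varphi_1\mathbb{U}_{\phi}\varphi_2$ iff there is a strict $[\![\phi]\!]$-subtree $\mathcal{T}'$ of $\mathcal{T}$ with $\mathcal{T}'\models_{\mathcal{T}^\star}\varphi_2$ and, for every strict $[\![\phi]\!]$-supertree $\mathcal{T}''$ of $\mathcal{T}'$ that is a strict $[\![\phi]\!]$-subtree of $\mathcal{T}$, $\mathcal{T}''\models_{\mathcal{T}^\star}\varphi_1$. - $\mathcal{T}\models_{\mathcal{T}^\star}\varphi_1\mathbb{R}_{\phi}\varphi_2$ iff for every strict $[\![\phi]\!]$-subtree $\mathcal{T}'$ of $\mathcal{T}$, either $\mathcal{T}'\models_{\mathcal{T}^\star}\varphi_2$ or there is a strict $[\![\phi]\!]$-supertree $\mathcal{T}''$ of $\mathcal{T}'$ that is a strict $[\![\phi]\!]$-subtree of $\mathcal{T}$ with $\mathcal{T}''\models_{\mathcal{T}^\star}\varphi_1$. - $\mathcal{T}\models_{\mathcal{T}^\star}\varphi_1\mathbb{S}_{\phi}\varphi_2$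 iff there is a strict $[\![\phi]\!]$-supertree $\mathcal{T}'$ of $\mathcal{T}$ that is a subtree of $\mathcal{T}^\star$ with $\mathcal{T}'\models_{\mathcal{T}^\star}\varphi_2$ and, for every strict $[\![\phi]\!]$-subtree $\mathcal{T}''$ of $\mathcal{T}'$ that is a strict $[\![\phi]\!]$-supertree of $\mathcal{T}$, $\mathcal{T}''\models_{\mathcal{T}^\star}\varphi_1$. - $\mathcal{T}\models_{\mathcal{T}^\star}\varphi_1\mathbb{B}_{\phi}\varphi_2$ iff for every strict $[\![\phi]\!]$-supertree $\mathcal{T}'$ of $\mathcal{T}$ that is a subtree of $\mathcal{T}^\star$, either $\mathcal{T}'\models_{\mathcal{T}^\star}\varphi_2$ or there is a strict $[\![\phi]\!]$-subtree $\mathcal{T}''$ of $\mathcal{T}'$ that is a strict $[\![\phi]\!]$-supertree of $\mathcal{T}$ with $\mathcal{T}''\models_{\mathcal{T}^\star}\varphi_1$. A Kripke tree $\mathcal{T}$ satisfies $\varphi$ if $\mathcal{T}\models_{\mathcal{T}}\varphi$. Expressiveness. Two sentences over $AP$ are equivalent if they are satisfied by the same Kripke trees over $AP$. $L\le L'$ means that, for every finite $AP$, each $L$-sentence over $AP$ has an equivalent $L'$-sentence over $AP$; $L\not\le L'$ is its negation. -}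

module Defs where

open import Level using (Lift; 0ℓ) renaming (suc to lsuc)
open import Data.Nat using (ℕ; zero; suc; _≤_; _<_)
open import Data.Fin using (Fin)
open import Data.List using (List; []; _++_; _∷ʳ_)
open import Data.List.Properties using (++-assoc; ++-identityʳ)
open import Data.Vec using (Vec; []; _∷_; lookup)
open import Data.Product using (Σ; Σ-syntax; ∃; ∃-syntax; _×_; _,_; proj₁; proj₂)
open import Data.Sum using (_⊎_)
open import Data.Unit using (⊤)
open import Function using (_↔_; _⇔_)
open import Relation.Nullary using (¬_)
open import Relation.Unary using (Pred; _∈_; _⊆_)
open import Relation.Binary.PropositionalEquality
  using (_≡_; refl; sym; trans; cong; subst)

------------------------------------------------------------------------
-- Trees

Word : Set
Word = List ℕ

infix 4 _≼_

-- σ is a prefix of τ; on the nodes of a tree, τ is a descendant of σ.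
_≼_ : Word → Word → Set
σ ≼ τ = ∃[ υ ] τ ≡ σ ++ υ

record IsTree (S : Pred Word 0ℓ) (root : Word) : Set where
  field
    root∈  : root ∈ S
    rooted : ∀ {τ} → τ ∈ S → ∃[ τ′ ] τ ≡ root ++ τ′
    closed : ∀ {τ τ′} → root ++ τ ∈ S → τ′ ≼ τ → root ++ τ′ ∈ S

record Tree : Set₁ where
  field
    nodes  : Pred Word 0ℓ
    root   : Word
    isTree : IsTree nodes root

  open IsTree isTree public

open Tree public using (nodes; root)

infix 4 _⊑_

_⊑_ : Tree → Tree → Set
S ⊑ T = nodes S ⊆ nodes T

IsPath : Tree → Set
IsPath T = ∀ {τ m n} → τ ∈ nodes T → τ ∷ʳ m ∈ nodes T → τ ∷ʳ n ∈ nodes T → m ≡ n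

NonBlocking : Tree → Set
NonBlocking T = ∀ {τ} → τ ∈ nodes T → ∃[ n ] τ ∷ʳ n ∈ nodes T

record NBTree : Set₁ where
  field
    tree        : Tree
    nonBlocking : NonBlocking tree

open NBTree public

-- The labelling is a total function on words; its values outside the tree
-- are never inspected.  A Kripke subtree is given by its underlying
-- non-blocking tree alone, since it inherits the labelling.
record KripkeTree (AP : Set) : Set₁ where
  field
    carrier : NBTree
    lab     : Word → Pred AP 0ℓ

open KripkeTree public

------------------------------------------------------------------------
-- Logics and expressiveness

record Logic : Set₂ where
  field
    Sentence : Set → Set
    Sat      : ∀ {AP} → KripkeTree AP → Sentence AP → Set₁

open Logic public

Finite : Set → Set
Finite A = ∃[ n ] (A ↔ Fin n)

-- Equivalence of sentences, possibly of two different logics.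
Equivalent : (L L′ : Logic) {AP : Set} → Sentence L AP → Sentence L′ AP → Set₁
Equivalent L L′ {AP} φ φ′ = (𝒯 : KripkeTree AP) → Sat L 𝒯 φ ⇔ Sat L′ 𝒯 φ′

infix 4 _≤ᴸ_ _≰ᴸ_

_≤ᴸ_ : Logic → Logic → Set₁
L ≤ᴸ L′ = (AP : Set) → Finite AP →
  (φ : Sentence L AP) → Σ[ φ′ ∈ Sentence L′ AP ] Equivalent L L′ φ φ′

_≰ᴸ_ : Logic → Logic → Set₁
L ≰ᴸ L′ = ¬ (L ≤ᴸ L′)

------------------------------------------------------------------------
-- Monadic tree logic and monadic path logic

-- De Bruijn indices: m first-order and n second-order variables in scope.
data Monadic (AP : Set) (m n : ℕ) : Set where
  lab[_] : AP → Fin m → Monadic AP m n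
  _≤′_   : Fin m → Fin m → Monadic AP m n
  _∈′_   : Fin m → Fin n → Monadic AP m n
  ¬′_    : Monadic AP m n → Monadic AP m n
  _∧′_   : Monadic AP m n → Monadic AP m n → Monadic AP m n
  ∃¹_    : Monadic AP (suc m) n → Monadic AP m n
  ∃²_    : Monadic AP m (suc n) → Monadic AP m n

-- Second-order variables range over the subtrees (with any root) satisfying R.
module MonadicSemantics (R : Tree → Set) {AP : Set} (𝒯 : KripkeTree AP) where

  private T = tree (carrier 𝒯)

  ⟦_⟧ : ∀ {m n} → Monadic AP m n → Vec Word m → Vec Tree n → Set₁
  ⟦ lab[ a ] x ⟧ ρ σ = Lift _ (a ∈ lab 𝒯 (lookup ρ x))
  ⟦ x ≤′ y ⟧     ρ σ = Lift _ (lookup ρ x ≼ lookup ρ y)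
  ⟦ x ∈′ X ⟧     ρ σ = Lift _ (lookup ρ x ∈ nodes (lookup σ X))
  ⟦ ¬′ φ ⟧       ρ σ = ¬ ⟦ φ ⟧ ρ σ
  ⟦ φ ∧′ χ ⟧     ρ σ = ⟦ φ ⟧ ρ σ × ⟦ χ ⟧ ρ σ
  ⟦ ∃¹ φ ⟧       ρ σ = ∃[ τ ] (τ ∈ nodes T × ⟦ φ ⟧ (τ ∷ ρ) σ)
  ⟦ ∃² φ ⟧       ρ σ = ∃[ X ] (X ⊑ T × R X × ⟦ φ ⟧ ρ (X ∷ σ))

monadicLogic : (Tree → Set) → Logic
monadicLogic R = record
  { Sentence = λ AP → Monadic AP 0 0
  ; Sat      = λ 𝒯 φ → MonadicSemantics.⟦_⟧ R 𝒯 φ [] []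
  }

MTL : Logic
MTL = monadicLogic (λ _ → ⊤)

MPL : Logic
MPL = monadicLogic IsPath

------------------------------------------------------------------------
-- Kripke subtrees

infix 4 _⊑ʳ_

_⊑ʳ_ : NBTree → NBTree → Set
S ⊑ʳ T = root (tree S) ≡ root (tree T) × tree S ⊑ tree T

⊑ʳ-refl : ∀ {T} → T ⊑ʳ T
⊑ʳ-refl = refl , λ p → p

⊑ʳ-trans : ∀ {S T U} → S ⊑ʳ T → T ⊑ʳ U → S ⊑ʳ U
⊑ʳ-trans (e , s) (e′ , s′) = trans e e′ , λ p → s′ (s p)

-- T′ is a strict W-subtree of T.
StrictSub : ∀ {ℓ} → Pred Word ℓ → NBTree → NBTree → Set ℓ
StrictSub W T′ T =
    T′ ⊑ʳ T
  × ¬ (tree T ⊑ tree T′)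
  × (∀ {w n} → w ∈ W → w ∈ nodes (tree T′) →
       w ∷ʳ n ∈ nodes (tree T) → w ∷ʳ n ∈ nodes (tree T′))

-- T at p is the tree of all descendants of w in T, where p : w ∈ nodes T.
infix 6 _at_

_at_ : (T : NBTree) {w : Word} → w ∈ nodes (tree T) → NBTree
_at_ T {w} w∈ = record
  { tree = record
    { nodes  = λ τ → τ ∈ nodes (tree T) × w ≼ τ
    ; root   = w
    ; isTree = record
      { root∈  = w∈ , [] , sym (++-identityʳ w)
      ; rooted = proj₂
      ; closed = λ { {τ} {τ′} (p , _) (υ , eq) → closed′ p υ eq , τ′ , refl }
      }
    }
  ; nonBlocking = λ { {τ} (p , υ , eq) → let n , q = nonBlocking T p in
      n , q , υ ∷ʳ n , trans (cong (_∷ʳ n) eq) (++-assoc w υ _) }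
  }
  where
  closed′ : ∀ {τ τ′} → w ++ τ ∈ nodes (tree T) →
            ∀ υ → τ ≡ τ′ ++ υ → w ++ τ′ ∈ nodes (tree T)
  closed′ {τ′ = τ′} p υ refl with Tree.rooted (tree T) w∈
  ... | ω , refl =
    subst (nodes (tree T)) (sym (++-assoc r ω τ′))
      (Tree.closed (tree T) {τ′ = ω ++ τ′}
        (subst (nodes (tree T)) (++-assoc r ω (τ′ ++ υ)) p)
        (υ , sym (++-assoc ω τ′ υ)))
    where r = root (tree T)

at-mono : ∀ {S T} (s : S ⊑ʳ T) {w} (p : w ∈ nodes (tree S)) →
          S at p ⊑ʳ T at (proj₂ s p)
at-mono (_ , s) _ = refl , λ (q , d) → s q , d

-- The infinite paths from the root of T: a path is infinite iff it is
-- non-blocking.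
record InfPath (T : NBTree) : Set₁ where
  field
    path   : NBTree
    isPath : IsPath (tree path)
    within : path ⊑ʳ T

  node : ℕ → ∃ (nodes (tree path))
  node zero    = root (tree path) , Tree.root∈ (tree path)
  node (suc i) = let _ , p = node i ; _ , q = nonBlocking path p in _ , q

  node∈ : (i : ℕ) → proj₁ (node i) ∈ nodes (tree T)
  node∈ i = proj₂ within (proj₂ (node i))

------------------------------------------------------------------------
-- Substructure temporal logic

mutual

  data StateF (AP : Set) : Set where
    atom        : AP → StateF AP
    ¬ˢ_         : StateF AP → StateF AP
    _∧ˢ_ _∨ˢ_   : StateF AP → StateF AP → StateF AP
    _𝕌[_]_      : StateF AP → StateF AP → StateF AP → StateF AP
    _ℝ[_]_      : StateF AP → StateF AP → StateF AP → StateF AP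
    _𝕊[_]_      : StateF AP → StateF AP → StateF AP → StateF AP
    _𝔹[_]_      : StateF AP → StateF AP → StateF AP → StateF AP
    E A         : PathF AP → StateF AP

  data PathF (AP : Set) : Set where
    state       : StateF AP → PathF AP
    ¬ᵖ_         : PathF AP → PathF AP
    _∧ᵖ_ _∨ᵖ_   : PathF AP → PathF AP → PathF AP
    X           : PathF AP → PathF AP
    _U_ _R_     : PathF AP → PathF AP → PathF AP

module STLSemantics {AP : Set} (label : Word → Pred AP 0ℓ) where

  mutual

    -- models T⋆ T s φ is 𝒯 ⊨_{𝒯⋆} φ.
    models : (T⋆ T : NBTree) → T ⊑ʳ T⋆ → StateF AP → Set₁
    models T⋆ T s (atom a)   = Lift _ (a ∈ label (root (tree T)))
    models T⋆ T s (¬ˢ φ)     = ¬ models T⋆ T s φ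
    models T⋆ T s (φ₁ ∧ˢ φ₂) = models T⋆ T s φ₁ × models T⋆ T s φ₂
    models T⋆ T s (φ₁ ∨ˢ φ₂) = models T⋆ T s φ₁ ⊎ models T⋆ T s φ₂
    models T⋆ T s (φ₁ 𝕌[ ϕ ] φ₂) =
      ∃[ T′ ] Σ[ s′ ∈ T′ ⊑ʳ T⋆ ]
        StrictSub W T′ T
      × models T⋆ T′ s′ φ₂
      × (∀ T″ (s″ : T″ ⊑ʳ T⋆) → StrictSub W T′ T″ → StrictSub W T″ T →
           models T⋆ T″ s″ φ₁)
      where W = extension T⋆ T s ϕ
    models T⋆ T s (φ₁ ℝ[ ϕ ] φ₂) =
      ∀ T′ (s′ : T′ ⊑ʳ T⋆) → StrictSub W T′ T →
        models T⋆ T′ s′ φ₂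
      ⊎ (∃[ T″ ] Σ[ s″ ∈ T″ ⊑ʳ T⋆ ]
           StrictSub W T′ T″ × StrictSub W T″ T × models T⋆ T″ s″ φ₁)
      where W = extension T⋆ T s ϕ
    models T⋆ T s (φ₁ 𝕊[ ϕ ] φ₂) =
      ∃[ T′ ] Σ[ s′ ∈ T′ ⊑ʳ T⋆ ]
        StrictSub W T T′
      × models T⋆ T′ s′ φ₂
      × (∀ T″ (s″ : T″ ⊑ʳ T⋆) → StrictSub W T″ T′ → StrictSub W T T″ →
           models T⋆ T″ s″ φ₁)
      where W = extension T⋆ T s ϕ
    models T⋆ T s (φ₁ 𝔹[ ϕ ] φ₂) =
      ∀ T′ (s′ : T′ ⊑ʳ T⋆) → StrictSub W T T′ →
        models T⋆ T′ s′ φ₂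
      ⊎ (∃[ T″ ] Σ[ s″ ∈ T″ ⊑ʳ T⋆ ]
           StrictSub W T″ T′ × StrictSub W T T″ × models T⋆ T″ s″ φ₁)
      where W = extension T⋆ T s ϕ
    models T⋆ T s (E ψ) = Σ[ π ∈ InfPath T ] holds T⋆ T s π 0 ψ
    models T⋆ T s (A ψ) = (π : InfPath T) → holds T⋆ T s π 0 ψ

    -- The set ⟦ ϕ ⟧ of nodes of T.
    extension : (T⋆ T : NBTree) → T ⊑ʳ T⋆ → StateF AP → Pred Word (lsuc 0ℓ)
    extension T⋆ T s ϕ w = Σ[ p ∈ nodes (tree T) w ]
      models (T⋆ at proj₂ s p) (T at p) (at-mono {T} {T⋆} s p) ϕ

    -- The path π satisfies the path formula at position i.
    holds : (T⋆ T : NBTree) → T ⊑ʳ T⋆ → InfPath T → ℕ → PathF AP → Set₁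
    holds T⋆ T s π i (state φ) =
      models (T⋆ at proj₂ s p) (T at p) (at-mono {T} {T⋆} s p) φ
      where p = InfPath.node∈ π i
    holds T⋆ T s π i (¬ᵖ ψ)     = ¬ holds T⋆ T s π i ψ
    holds T⋆ T s π i (ψ₁ ∧ᵖ ψ₂) = holds T⋆ T s π i ψ₁ × holds T⋆ T s π i ψ₂
    holds T⋆ T s π i (ψ₁ ∨ᵖ ψ₂) = holds T⋆ T s π i ψ₁ ⊎ holds T⋆ T s π i ψ₂
    holds T⋆ T s π i (X ψ)      = holds T⋆ T s π (suc i) ψ
    holds T⋆ T s π i (ψ₁ U ψ₂)  = ∃[ j ]
      (i ≤ j × holds T⋆ T s π j ψ₂ ×
       (∀ k → i ≤ k → k < j → holds T⋆ T s π k ψ₁))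
    holds T⋆ T s π i (ψ₁ R ψ₂)  = ∀ j → i ≤ j →
      holds T⋆ T s π j ψ₂ ⊎ (∃[ k ] (i ≤ k × k < j × holds T⋆ T s π k ψ₁))

STL* : Logic
STL* = record
  { Sentence = StateF
  ; Sat      = λ 𝒯 φ → STLSemantics.models (lab 𝒯)
                 (carrier 𝒯) (carrier 𝒯) (⊑ʳ-refl {carrier 𝒯}) φ
  }

{-# OPTIONS --safe #-}
-- STL* into MTL: a state formula becomes a formula with two free tree
-- variables, for 𝒯⋆ and 𝒯.  All relations between trees and nodes used by the
-- semantics are definable, and the i-th position of a path is identified with
-- the i-th node on it.
--
-- STL* against MPL: take a comb, an infinite spine with an infinite tooth at
-- every spine node, and mark the n-th spine node.  STL* expresses that n is
-- even by selecting a subcomb whose teeth alternate up to the mark, starting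
-- and ending with a tooth.  A path of the comb is determined by its root and
-- its end, so MPL on the comb is no stronger than first-order logic over
-- (ℕ, ≤), for which n and n + 1 are indistinguishable once n is large: inserting
-- a new spine node far from all chosen ones and from the mark is not noticed.
module Submission where

open import Defs
open import Level using (Level; _⊔_; Lift; lift; lower; 0ℓ) renaming (suc to lsuc)
open import Axiom.ExcludedMiddle using (ExcludedMiddle)
open import Data.Bool using (Bool; true; false)
open import Data.Fin using (Fin; zero; suc)
open import Data.Fin.Properties using (2↔Bool)
open import Data.List using ([]; _∷_; _++_; _∷ʳ_; length; replicate; initLast; _∷ʳ′_)
open import Data.List.Properties
  using (++-assoc; ++-identityʳ; length-++; length-replicate;
         ∷-injectiveˡ; ∷-injectiveʳ; ∷ʳ-injective)
open import Data.Maybe using (Maybe; just; nothing)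
open import Data.Maybe.Relation.Binary.Pointwise using (Pointwise; just; nothing)
open import Data.Nat using (ℕ; zero; suc; _+_; _∸_; _≤_; _<_; z≤n; s≤s; s≤s⁻¹)
open import Data.Nat.Properties
open import Data.Product using (Σ; Σ-syntax; ∃-syntax; _×_; _,_; proj₁; proj₂)
open import Data.Product.Function.NonDependent.Propositional using (_×-⇔_)
open import Data.Sum using (_⊎_; inj₁; inj₂)
open import Data.Sum.Function.Propositional using (_⊎-⇔_)
open import Data.Unit using (⊤; tt)
open import Data.Vec using (Vec; []; _∷_; lookup)
open import Function using (_⇔_; mk⇔; Equivalence; _∘_; id)
open import Function.Properties.Inverse using (↔-sym)
open import Function.Related.TypeIsomorphisms using (¬-cong-⇔)
open import Relation.Nullary using (¬_; Dec; yes; no; contradiction)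
open import Relation.Nullary.Decidable using (¬?)
open import Relation.Unary using (Pred; _∈_; _≐_)
open import Relation.Binary.PropositionalEquality
  using (_≡_; refl; sym; trans; cong; cong₂; subst)

open Equivalence using (to; from)

private variable
  a b : Level
  AP : Set
  m n i j k l i′ j′ k′ : ℕ
  I I′ J : Maybe ℕ

-- Words and prefixes

≼-refl : ∀ {σ} → σ ≼ σ
≼-refl = [] , sym (++-identityʳ _)

≼-reflexive : ∀ {σ τ} → σ ≡ τ → σ ≼ τ
≼-reflexive refl = ≼-refl

≼-trans : ∀ {ρ σ τ} → ρ ≼ σ → σ ≼ τ → ρ ≼ τ
≼-trans {ρ} (υ , refl) (υ′ , refl) = υ ++ υ′ , ++-assoc ρ υ υ′

≼-∷ʳ : ∀ {τ k} → τ ≼ τ ∷ʳ k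
≼-∷ʳ = _ , refl

≼-length : ∀ {σ τ} → σ ≼ τ → length σ ≤ length τ
≼-length {σ} (υ , refl) =
  subst (length σ ≤_) (sym (length-++ σ)) (m≤m+n (length σ) (length υ))

length-∷ʳ : ∀ (τ : Word) k → length (τ ∷ʳ k) ≡ suc (length τ)
length-∷ʳ τ k = trans (length-++ τ) (+-comm (length τ) 1)

≼-length-≡ : ∀ {σ τ} → σ ≼ τ → length τ ≤ length σ → σ ≡ τ
≼-length-≡ {σ} ([] , refl) _ = sym (++-identityʳ σ)
≼-length-≡ {σ} (k ∷ υ , refl) τ≤σ =
  contradiction (subst (_≤ length σ) (length-++ σ) τ≤σ) (m+1+n≰m (length σ))

≼-antisym : ∀ {σ τ} → σ ≼ τ → τ ≼ σ → σ ≡ τ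
≼-antisym p q = ≼-length-≡ p (≼-length q)

∷ʳ⋠ : ∀ {τ k} → ¬ (τ ∷ʳ k ≼ τ)
∷ʳ⋠ {τ} {k} p = 1+n≰n (subst (_≤ length τ) (length-∷ʳ τ k) (≼-length p))

-- The second disjunct is the case of a nonempty suffix. Both disjuncts are phrased with `≼`,
-- because the formulas to be matched have no equality.
≼-∷ʳ⁻ : ∀ {σ τ k} → σ ≼ τ ∷ʳ k → τ ∷ʳ k ≼ σ ⊎ σ ≼ τ
≼-∷ʳ⁻ {σ} {τ} (υ , eq) with initLast υ
... | []       = inj₁ (≼-reflexive (trans eq (++-identityʳ σ)))
... | υ′ ∷ʳ′ l =
  inj₂ (υ′ , proj₁ (∷ʳ-injective τ (σ ++ υ′) (trans eq (sym (++-assoc σ υ′ _)))))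

∷ʳ-≼⁻ : ∀ {τ k l} → τ ∷ʳ k ≼ τ ∷ʳ l → k ≡ l
∷ʳ-≼⁻ {τ} {k} {l} p = proj₂ (∷ʳ-injective τ τ
  (≼-length-≡ p (≤-reflexive (trans (length-∷ʳ τ l) (sym (length-∷ʳ τ k))))))

root≼ : ∀ T {τ} → τ ∈ nodes T → root T ≼ τ
root≼ T = Tree.rooted T

root∈ : ∀ T → root T ∈ nodes T
root∈ = Tree.root∈

-- `Tree.closed` compares words relative to the root; the node `ρ`, a prefix of `σ`, shows that `σ`
-- extends the root as well.
convex : ∀ T {ρ σ τ} → ρ ∈ nodes T → τ ∈ nodes T → ρ ≼ σ → σ ≼ τ → σ ∈ nodes T
convex T ρ∈ τ∈ ρ≼σ (υ′ , refl) with ≼-trans (root≼ T ρ∈) ρ≼σ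
... | υ , refl =
  Tree.closed T (subst (nodes T) (++-assoc (root T) υ υ′) τ∈) (υ′ , refl)

-- The order-theoretic description of the root, needed because formulas have no constant for it.
root-unique : ∀ T {τ} → τ ∈ nodes T → (∀ σ → σ ∈ nodes T → τ ≼ σ) → τ ≡ root T
root-unique T τ∈ τ≼ = ≼-antisym (τ≼ _ (root∈ T)) (root≼ T τ∈)

-- Infinite paths

module _ {T : NBTree} (π : InfPath T) where
  open InfPath π

  pos : ℕ → Word
  pos i = proj₁ (node i)

  -- On a path, length determines position; this turns prefix comparisons and child steps back into
  -- arithmetic.
  pos-length : ∀ i → length (pos i) ≡ length (root (tree T)) + i
  pos-length zero    = trans (cong length (proj₁ within)) (sym (+-identityʳ _))
  pos-length (suc i) =
    trans (length-∷ʳ (pos i) _) (trans (cong suc (pos-length i)) (sym (+-suc _ i)))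

  pos-mono-+ : ∀ i k → pos i ≼ pos (k + i)
  pos-mono-+ i zero    = ≼-refl
  pos-mono-+ i (suc k) = ≼-trans (pos-mono-+ i k) ≼-∷ʳ

  pos-mono : ∀ {i j} → i ≤ j → pos i ≼ pos j
  pos-mono {i} {j} i≤j = subst (λ k → pos i ≼ pos k) (m∸n+n≡m i≤j) (pos-mono-+ i (j ∸ i))

  pos-cancel : ∀ {i j} → pos i ≼ pos j → i ≤ j
  pos-cancel {i} {j} p = +-cancelˡ-≤ (length (root (tree T))) i j
    (subst (_≤ _) (pos-length i) (subst (_ ≤_) (pos-length j) (≼-length p)))

  pos-child : ∀ {i j k} → pos j ≡ pos i ∷ʳ k → j ≡ suc i
  pos-child {i} {j} {k} eq = +-cancelˡ-≡ (length (root (tree T))) j (suc i)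
    (trans (sym (pos-length j)) (trans (cong length eq) (trans (length-∷ʳ (pos i) k)
      (trans (cong suc (pos-length i)) (sym (+-suc _ i))))))

  -- Following the word letter by letter, `isPath` forces each next letter to be the one that
  -- `nonBlocking` selects for `node`. This lets quantifiers over the nodes of a path stand for
  -- quantifiers over positions.
  pos-surjective : ∀ {τ} → τ ∈ nodes (tree path) → ∃[ i ] τ ≡ pos i
  pos-surjective τ∈ with Tree.rooted (tree path) τ∈
  ... | υ , refl = go 0 υ τ∈
    where
    go : ∀ i υ → pos i ++ υ ∈ nodes (tree path) → ∃[ j ] pos i ++ υ ≡ pos j
    go i []      τ∈ = i , ++-identityʳ _
    go i (k ∷ υ) τ∈ = subst (λ τ → ∃[ j ] τ ≡ pos j) (sym split)
                        (go (suc i) υ (subst (nodes (tree path)) split τ∈))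
      where
      child∈ : pos i ∷ʳ k ∈ nodes (tree path)
      child∈ = convex (tree path) (proj₂ (node i)) τ∈ ≼-∷ʳ (υ , sym (++-assoc (pos i) _ υ))

      split : pos i ++ k ∷ υ ≡ pos (suc i) ++ υ
      split = trans (sym (++-assoc (pos i) _ υ))
        (cong (λ l → pos i ∷ʳ l ++ υ) (isPath (proj₂ (node i)) child∈ (proj₂ (node (suc i)))))

-- Derived connectives of monadic tree logic

infixr 5 _⇒_
infixr 6 _⊕_
infixr 7 _&_

_&_ _⊕_ _⇒_ : Monadic AP m n → Monadic AP m n → Monadic AP m n
φ & χ = φ ∧′ χ
φ ⊕ χ = ¬′ ((¬′ φ) ∧′ (¬′ χ))
φ ⇒ χ = ¬′ (φ ∧′ (¬′ χ))

∀¹ : Monadic AP (suc m) n → Monadic AP m n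
∀¹ φ = ¬′ (∃¹ (¬′ φ))

∀² : Monadic AP m (suc n) → Monadic AP m n
∀² φ = ¬′ (∃² (¬′ φ))

∃∈ ∀∈ : Fin n → Monadic AP (suc m) n → Monadic AP m n
∃∈ x φ = ∃¹ ((zero ∈′ x) & φ)
∀∈ x φ = ∀¹ ((zero ∈′ x) ⇒ φ)

-- A child is a cover in the order `≼`: nothing lies strictly between `x` and `y`. Formulas can
-- speak of the order only, not of letters.
childF : Fin m → Fin m → Monadic AP m n
childF x y = (x ≤′ y) & (¬′ (y ≤′ x)) & ∀¹ ((zero ≤′ suc y) ⇒ (suc y ≤′ zero) ⊕ (zero ≤′ suc x))

subF sameRootF rsubF : Fin n → Fin n → Monadic AP m n
subF s t      = ∀∈ s (zero ∈′ t)
sameRootF s t = ∃∈ s (∀∈ t (suc zero ≤′ zero))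
rsubF s t     = subF s t & sameRootF s t

atRootF : Fin n → Monadic AP (suc m) n → Monadic AP m n
atRootF t φ = ∃∈ t (∀∈ t (suc zero ≤′ zero) & φ)

nonBlockingF pathF : Fin n → Monadic AP m n
nonBlockingF t = ∀∈ t (∃∈ t (childF (suc zero) zero))
pathF t = ∀∈ t (∀∈ t (∀∈ t
  -- The final atom is `≤′` in place of equality; it suffices because two children of one node have
  -- the same length.
  (childF (suc (suc zero)) (suc zero) ⇒ childF (suc (suc zero)) zero ⇒ (suc zero ≤′ zero))))

strictSubF : Monadic AP (suc m) n → Fin n → Fin n → Monadic AP m n
strictSubF W s t = rsubF s t & (¬′ subF t s) &
  ∀∈ s (W ⇒ ∀∈ t (childF (suc zero) zero ⇒ (zero ∈′ s)))

descendantsF : Fin m → Fin n → Fin n → Monadic AP m n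
descendantsF x s t = subF′ & ∀∈ t ((suc x ≤′ zero) ⇒ (zero ∈′ s))
  where subF′ = ∀∈ s ((zero ∈′ t) & (suc x ≤′ zero))

∃ˢ ∀ˢ ∃ᵖ ∀ᵖ : Fin n → Monadic AP m (suc n) → Monadic AP m n
∃ˢ t φ = ∃² ((rsubF zero (suc t) & nonBlockingF zero) & φ)
∀ˢ t φ = ∀² ((rsubF zero (suc t) & nonBlockingF zero) ⇒ φ)
∃ᵖ t φ = ∃ˢ t (pathF zero & φ)
∀ᵖ t φ = ∀ˢ t (pathF zero ⇒ φ)

-- s and t are the variables for 𝒯⋆ and 𝒯, π the one for the
-- current path and x the one for the current node on it.

mutual
  trS : StateF AP → (s t : Fin n) → Monadic AP m n
  trS (atom p)       s t = atRootF t (lab[ p ] zero)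
  trS (¬ˢ φ)         s t = ¬′ trS φ s t
  trS (φ₁ ∧ˢ φ₂)     s t = trS φ₁ s t & trS φ₂ s t
  trS (φ₁ ∨ˢ φ₂)     s t = trS φ₁ s t ⊕ trS φ₂ s t
  trS (φ₁ 𝕌[ ϕ ] φ₂) s t =
    ∃ˢ s (strictSubF (trW ϕ (suc s) (suc t)) zero (suc t) & trS φ₂ (suc s) zero &
      -- Below the inner quantifier, too, `W` is evaluated in the original 𝒯, so `trW` keeps the
      -- shifted `t` and never takes the variable of an intermediate tree.
      ∀ˢ (suc s) (strictSubF (trW ϕ (suc (suc s)) (suc (suc t))) (suc zero) zero ⇒
                  strictSubF (trW ϕ (suc (suc s)) (suc (suc t))) zero (suc (suc t)) ⇒
                  trS φ₁ (suc (suc s)) zero))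
  trS (φ₁ ℝ[ ϕ ] φ₂) s t =
    ∀ˢ s (strictSubF (trW ϕ (suc s) (suc t)) zero (suc t) ⇒ trS φ₂ (suc s) zero ⊕
      ∃ˢ (suc s) (strictSubF (trW ϕ (suc (suc s)) (suc (suc t))) (suc zero) zero &
                  strictSubF (trW ϕ (suc (suc s)) (suc (suc t))) zero (suc (suc t)) &
                  trS φ₁ (suc (suc s)) zero))
  trS (φ₁ 𝕊[ ϕ ] φ₂) s t =
    ∃ˢ s (strictSubF (trW ϕ (suc s) (suc t)) (suc t) zero & trS φ₂ (suc s) zero &
      ∀ˢ (suc s) (strictSubF (trW ϕ (suc (suc s)) (suc (suc t))) zero (suc zero) ⇒
                  strictSubF (trW ϕ (suc (suc s)) (suc (suc t))) (suc (suc t)) zero ⇒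
                  trS φ₁ (suc (suc s)) zero))
  trS (φ₁ 𝔹[ ϕ ] φ₂) s t =
    ∀ˢ s (strictSubF (trW ϕ (suc s) (suc t)) (suc t) zero ⇒ trS φ₂ (suc s) zero ⊕
      ∃ˢ (suc s) (strictSubF (trW ϕ (suc (suc s)) (suc (suc t))) zero (suc zero) &
                  strictSubF (trW ϕ (suc (suc s)) (suc (suc t))) (suc (suc t)) zero &
                  trS φ₁ (suc (suc s)) zero))
  trS (E ψ) s t = ∃ᵖ t (atRootF zero (trP ψ (suc s) (suc t) zero zero))
  trS (A ψ) s t = ∀ᵖ t (atRootF zero (trP ψ (suc s) (suc t) zero zero))

  -- State formulas at a node are evaluated in the trees of its descendants. The quantifiers are not
  -- relativised to rooted subtrees, since the root changes; `descendantsF` determines their values.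
  trAt : StateF AP → (s t : Fin n) → Fin m → Monadic AP m n
  trAt φ s t x = ∃² (descendantsF x zero (suc s) &
    ∃² (descendantsF x zero (suc (suc t)) & trS φ (suc zero) zero))

  trW : StateF AP → (s t : Fin n) → Monadic AP (suc m) n
  trW ϕ s t = (zero ∈′ t) & trAt ϕ s t zero

  trP : PathF AP → (s t π : Fin n) → Fin m → Monadic AP m n
  trP (state φ)  s t π x = trAt φ s t x
  trP (¬ᵖ ψ)     s t π x = ¬′ trP ψ s t π x
  trP (ψ₁ ∧ᵖ ψ₂) s t π x = trP ψ₁ s t π x & trP ψ₂ s t π x
  trP (ψ₁ ∨ᵖ ψ₂) s t π x = trP ψ₁ s t π x ⊕ trP ψ₂ s t π x
  trP (X ψ)      s t π x = ∃∈ π (childF (suc x) zero & trP ψ s t π zero)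
  trP (ψ₁ U ψ₂)  s t π x = ∃∈ π ((suc x ≤′ zero) & trP ψ₂ s t π zero &
    ∀∈ π ((suc (suc x) ≤′ zero) ⇒ (¬′ (suc zero ≤′ zero)) ⇒ trP ψ₁ s t π zero))
  trP (ψ₁ R ψ₂)  s t π x = ∀∈ π ((suc x ≤′ zero) ⇒ trP ψ₂ s t π zero ⊕
    ∃∈ π ((suc (suc x) ≤′ zero) & (¬′ (suc zero ≤′ zero)) & trP ψ₁ s t π zero))

-- At the outset 𝒯⋆ and 𝒯 are both the whole tree, so one variable, forced to contain every node,
-- serves for both.
sentence : StateF AP → Monadic AP 0 0
sentence φ = ∃² (∀¹ (zero ∈′ zero) & trS φ zero zero)

-- Correctness of the translation

module TranslationCorrect (em : ExcludedMiddle (lsuc 0ℓ)) {AP : Set} (𝒯 : KripkeTree AP) where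

  open MonadicSemantics (λ _ → ⊤) 𝒯
  open STLSemantics (lab 𝒯)

  private
    T₀ = tree (carrier 𝒯)

  -- Needed because `⊕`, `⇒` and the universal quantifiers are encoded through negation; this is the
  -- only use of excluded middle in the translation.
  by-contradiction : {P : Set₁} → ¬ ¬ P → P
  by-contradiction {P} ¬¬p with em {P}
  ... | yes p = p
  ... | no ¬p = contradiction ¬p ¬¬p

  infix 3 _,_⊢_≈_

  record _,_⊢_≈_ {m n} (ρ : Vec Word m) (σ : Vec Tree n) (P : Set a) (φ : Monadic AP m n) :
                 Set (a ⊔ lsuc 0ℓ) where
    constructor ⟪_⟫
    field iff : P ⇔ ⟦ φ ⟧ ρ σ

  open _,_⊢_≈_

  -- Agreement is required of the node sets only. A tree supplied by a second-order quantifier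
  -- equals the intended tree as a set of words, not as a record.
  record Denotes {n} (σ : Vec Tree n) (s : Fin n) (S : Tree) : Set where
    constructor denotes
    field
      value  : nodes (lookup σ s) ≐ nodes S
      within : S ⊑ T₀

  open Denotes

  module _ {m n : ℕ} {ρ : Vec Word m} {σ : Vec Tree n} where

    infixr 0 _⨾_

    _⨾_ : {P : Set a} {Q : Set b} {φ : Monadic AP m n} →
          P ⇔ Q → ρ , σ ⊢ Q ≈ φ → ρ , σ ⊢ P ≈ φ
    e ⨾ ⟪ f ⟫ = ⟪ mk⇔ (to f ∘ to e) (from e ∘ from f) ⟫

    ¬-correct : {P : Set a} {φ : Monadic AP m n} → ρ , σ ⊢ P ≈ φ → ρ , σ ⊢ ¬ P ≈ ¬′ φ
    ¬-correct ⟪ e ⟫ = ⟪ ¬-cong-⇔ e ⟫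

    ⊕-correct : {P : Set a} {Q : Set b} {φ χ : Monadic AP m n} →
                ρ , σ ⊢ P ≈ φ → ρ , σ ⊢ Q ≈ χ → ρ , σ ⊢ (P ⊎ Q) ≈ φ ⊕ χ
    ⊕-correct ⟪ e ⟫ ⟪ f ⟫ = e ⊎-⇔ f ⨾ ⟪ mk⇔
      (λ { (inj₁ p) (¬p , _) → ¬p p ; (inj₂ q) (_ , ¬q) → ¬q q })
      (λ h → by-contradiction λ k → h (k ∘ inj₁ , k ∘ inj₂)) ⟫

    -- The dependent form is for conditions whose second half uses the proof of the first, such as
    -- membership in `extension` or `IsPath` in `InfPath`.
    &-correctᵈ : {P : Set a} {Q : P → Set b} {φ χ : Monadic AP m n} →
                 ρ , σ ⊢ P ≈ φ → (∀ p → ρ , σ ⊢ Q p ≈ χ) → ρ , σ ⊢ Σ P Q ≈ φ & χ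
    &-correctᵈ ⟪ e ⟫ f = ⟪ mk⇔ (λ (p , q) → to e p , to (iff (f p)) q)
      (λ (p , q) → from e p , from (iff (f (from e p))) q) ⟫

    ⇒-correctᵈ : {P : Set a} {Q : P → Set b} {φ χ : Monadic AP m n} →
                 ρ , σ ⊢ P ≈ φ → (∀ p → ρ , σ ⊢ Q p ≈ χ) → ρ , σ ⊢ ((p : P) → Q p) ≈ φ ⇒ χ
    ⇒-correctᵈ ⟪ e ⟫ f = ⟪ mk⇔ (λ g (p , ¬q) → ¬q (to (iff (f (from e p))) (g (from e p))))
      (λ h p → from (iff (f p)) (by-contradiction λ ¬q → h (to e p , ¬q))) ⟫

    &-correct : {P : Set a} {Q : Set b} {φ χ : Monadic AP m n} →
                ρ , σ ⊢ P ≈ φ → ρ , σ ⊢ Q ≈ χ → ρ , σ ⊢ P × Q ≈ φ & χ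
    &-correct e f = &-correctᵈ e λ _ → f

    ⇒-correct : {P : Set a} {Q : Set b} {φ χ : Monadic AP m n} →
                ρ , σ ⊢ P ≈ φ → ρ , σ ⊢ Q ≈ χ → ρ , σ ⊢ (P → Q) ≈ φ ⇒ χ
    ⇒-correct e f = ⇒-correctᵈ e λ _ → f

    ∀¹-correct : {P : Pred Word a} {φ : Monadic AP (suc m) n} →
                 (∀ {τ} → τ ∈ nodes T₀ → τ ∷ ρ , σ ⊢ P τ ≈ φ) →
                 ρ , σ ⊢ (∀ τ → τ ∈ nodes T₀ → P τ) ≈ ∀¹ φ
    ∀¹-correct e = ⟪ mk⇔ (λ g (τ , τ∈ , ¬p) → ¬p (to (iff (e τ∈)) (g τ τ∈)))
      (λ h τ τ∈ → from (iff (e τ∈)) (by-contradiction λ ¬p → h (τ , τ∈ , ¬p))) ⟫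

    ∈-correct : ∀ {s S x} → Denotes σ s S → ρ , σ ⊢ lookup ρ x ∈ nodes S ≈ x ∈′ s
    ∈-correct (denotes (⊆S , S⊆) _) = ⟪ mk⇔ (λ p → lift (S⊆ p)) (λ p → ⊆S (lower p)) ⟫

    ≼-correct : ∀ {x y} → ρ , σ ⊢ lookup ρ x ≼ lookup ρ y ≈ x ≤′ y
    ≼-correct = ⟪ mk⇔ lift lower ⟫

    ∃∈-correct : ∀ {s S} → Denotes σ s S → {P : Pred Word a} {φ : Monadic AP (suc m) n} →
                 (∀ {τ} → τ ∈ nodes S → τ ∷ ρ , σ ⊢ P τ ≈ φ) →
                 ρ , σ ⊢ (∃[ τ ] (τ ∈ nodes S × P τ)) ≈ ∃∈ s φ
    ∃∈-correct (denotes (⊆S , S⊆) S⊑) e = ⟪ mk⇔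
      (λ (τ , τ∈ , p) → τ , S⊑ τ∈ , lift (S⊆ τ∈) , to (iff (e τ∈)) p)
      (λ (τ , _ , lift τ∈ , p) → τ , ⊆S τ∈ , from (iff (e (⊆S τ∈))) p) ⟫

    ∀∈-correct : ∀ {s S} → Denotes σ s S → {P : Pred Word a} {φ : Monadic AP (suc m) n} →
                 (∀ {τ} → τ ∈ nodes S → τ ∷ ρ , σ ⊢ P τ ≈ φ) →
                 ρ , σ ⊢ (∀ τ → τ ∈ nodes S → P τ) ≈ ∀∈ s φ
    ∀∈-correct (denotes (⊆S , S⊆) S⊑) e = ⟪ mk⇔
      (λ g (τ , _ , ¬f) → ¬f λ (lift τ∈ , ¬p) → ¬p (to (iff (e (⊆S τ∈))) (g τ (⊆S τ∈))))
      (λ h τ τ∈ → from (iff (e τ∈)) (by-contradiction λ ¬p →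
         h (τ , S⊑ τ∈ , λ f → f (lift (S⊆ τ∈) , ¬p)))) ⟫

  module _ {m n : ℕ} {ρ : Vec Word m} {σ : Vec Tree n} where

    child-correct : ∀ {x y} → lookup ρ x ∈ nodes T₀ → lookup ρ y ∈ nodes T₀ →
                    ρ , σ ⊢ (∃[ k ] lookup ρ y ≡ lookup ρ x ∷ʳ k) ≈ childF x y
    child-correct {x} {y} x∈ y∈ = mk⇔ fwd bwd ⨾
      &-correct ≼-correct (&-correct (¬-correct ≼-correct)
        (∀¹-correct λ _ → ⇒-correct ≼-correct (⊕-correct ≼-correct ≼-correct)))
      where
      σ′ = lookup ρ x
      τ′ = lookup ρ y
      Spec = σ′ ≼ τ′ × ¬ (τ′ ≼ σ′) × (∀ τ → τ ∈ nodes T₀ → τ ≼ τ′ → τ′ ≼ τ ⊎ τ ≼ σ′)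

      fwd : (∃[ k ] τ′ ≡ σ′ ∷ʳ k) → Spec
      fwd (k , eq) = subst (σ′ ≼_) (sym eq) ≼-∷ʳ
        , (λ p → ∷ʳ⋠ (subst (_≼ σ′) eq p))
        , λ τ _ τ≼ → subst (λ υ → υ ≼ τ ⊎ τ ≼ σ′) (sym eq) (≼-∷ʳ⁻ (subst (τ ≼_) eq τ≼))

      bwd : Spec → ∃[ k ] τ′ ≡ σ′ ∷ʳ k
      bwd (([] , eq) , τ⋠ , _) = contradiction (≼-reflexive (trans eq (++-identityʳ σ′))) τ⋠
      bwd ((k ∷ υ , eq) , _ , between)
        -- The covering condition is tested on the first node from `σ′` towards `τ′`, which belongs
        -- to the tree by convexity.
        with between (σ′ ∷ʳ k) (convex T₀ x∈ y∈ ≼-∷ʳ k≼) k≼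
        where
        k≼ : σ′ ∷ʳ k ≼ τ′
        k≼ = υ , trans eq (sym (++-assoc σ′ _ υ))
      ... | inj₁ τ≼ = k , ≼-antisym τ≼ (υ , trans eq (sym (++-assoc σ′ _ υ)))
      ... | inj₂ ≼σ = contradiction ≼σ ∷ʳ⋠

  module _ {m n : ℕ} {ρ : Vec Word m} {σ : Vec Tree n} where

    sub-correct : ∀ {s t S T} → Denotes σ s S → Denotes σ t T → ρ , σ ⊢ S ⊑ T ≈ subF s t
    sub-correct {s} {t} {S} {T} dS dT =
      mk⇔ (λ (i : S ⊑ T) τ → i {τ}) (λ f {τ} → f τ) ⨾ ∀∈-correct dS λ _ → ∈-correct dT

    rsub-correct : ∀ {s t S T} → Denotes σ s S → Denotes σ t T →
                   ρ , σ ⊢ (root S ≡ root T × S ⊑ T) ≈ rsubF s t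
    rsub-correct {S = S} {T} dS dT = mk⇔
      (λ (e , i) → (λ {τ} → i {τ}) , root S , root∈ S ,
         λ τ τ∈ → subst (_≼ τ) (sym e) (root≼ T τ∈))
      (λ { (i , τ , τ∈ , τ≼) → trans (sym (root-unique S τ∈ λ υ υ∈ → τ≼ υ (i υ∈)))
             (root-unique T (i τ∈) τ≼) , λ {τ} → i {τ} })
      ⨾ &-correct (sub-correct dS dT) (∃∈-correct dS λ _ → ∀∈-correct dT λ _ → ≼-correct)

    atRoot-correct : ∀ {t T} → Denotes σ t T → {P : Set a} {φ : Monadic AP (suc m) n} →
                     root T ∷ ρ , σ ⊢ P ≈ φ → ρ , σ ⊢ P ≈ atRootF t φ
    atRoot-correct {T = T} dT {φ = φ} ⟪ e ⟫ = mk⇔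
      (λ p → root T , root∈ T , (λ τ → root≼ T) , to e p)
      (λ { (τ , τ∈ , τ≼ , p) → from e (subst (λ τ → ⟦ φ ⟧ (τ ∷ ρ) σ) (root-unique T τ∈ τ≼) p) })
      ⨾ ∃∈-correct dT λ _ → &-correct (∀∈-correct dT λ _ → ≼-correct) ⟪ mk⇔ id id ⟫

    nonBlocking-correct : ∀ {t T} → Denotes σ t T → ρ , σ ⊢ NonBlocking T ≈ nonBlockingF t
    nonBlocking-correct {T = T} dT = mk⇔ fwd bwd
      ⨾ ∀∈-correct dT λ p → ∃∈-correct dT λ q → child-correct (within dT p) (within dT q)
      where
      Spec = ∀ τ → τ ∈ nodes T → ∃[ υ ] (υ ∈ nodes T × ∃[ k ] υ ≡ τ ∷ʳ k)

      fwd : NonBlocking T → Spec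
      fwd nb τ τ∈ = let k , q = nb τ∈ in τ ∷ʳ k , q , k , refl

      bwd : Spec → NonBlocking T
      bwd f {τ} τ∈ = let υ , υ∈ , k , eq = f τ τ∈ in k , subst (nodes T) eq υ∈

    path-correct : ∀ {t T} → Denotes σ t T → ρ , σ ⊢ IsPath T ≈ pathF t
    path-correct {T = T} dT = mk⇔ fwd bwd
      ⨾ ∀∈-correct dT λ p → ∀∈-correct dT λ q → ∀∈-correct dT λ r →
        ⇒-correct (child-correct (within dT p) (within dT q))
        (⇒-correct (child-correct (within dT p) (within dT r)) ≼-correct)
      where
      Spec = ∀ τ → τ ∈ nodes T → ∀ υ → υ ∈ nodes T → ∀ ω → ω ∈ nodes T →
             ∃[ k ] υ ≡ τ ∷ʳ k → ∃[ l ] ω ≡ τ ∷ʳ l → υ ≼ ω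

      fwd : IsPath T → Spec
      fwd path τ τ∈ _ p _ q (k , refl) (l , refl) = ≼-reflexive (cong (τ ∷ʳ_) (path τ∈ p q))

      bwd : Spec → IsPath T
      bwd f τ∈ p q = ∷ʳ-≼⁻ (f _ τ∈ _ p _ q (_ , refl) (_ , refl))

    strictSub-correct :
      ∀ {s t} S T {W : Pred Word a} {ω : Monadic AP (suc m) n} →
      Denotes σ s (tree S) → Denotes σ t (tree T) →
      (∀ {τ} → τ ∈ nodes T₀ → τ ∷ ρ , σ ⊢ W τ ≈ ω) →
      ρ , σ ⊢ StrictSub W S T ≈ strictSubF ω s t
    strictSub-correct S T {W} dS dT e =
      &-correct (rsub-correct dS dT) (&-correct (¬-correct (sub-correct dT dS)) (mk⇔ fwd bwd
        ⨾ ∀∈-correct dS λ p → ⇒-correct (e (within dS p))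
          (∀∈-correct dT λ q →
            ⇒-correct (child-correct (within dS p) (within dT q)) (∈-correct dS))))
      where
      Closed = ∀ {w k} → w ∈ W → w ∈ nodes (tree S) →
               w ∷ʳ k ∈ nodes (tree T) → w ∷ʳ k ∈ nodes (tree S)
      Spec = ∀ τ → τ ∈ nodes (tree S) → τ ∈ W → ∀ υ → υ ∈ nodes (tree T) →
             ∃[ k ] υ ≡ τ ∷ʳ k → υ ∈ nodes (tree S)

      fwd : Closed → Spec
      fwd f τ τ∈ w _ q (k , refl) = f w τ∈ q

      bwd : Spec → Closed
      bwd f w τ∈ q = f _ τ∈ w _ q (_ , refl)

  here : ∀ {n} {σ : Vec Tree n} {S} → S ⊑ T₀ → Denotes (S ∷ σ) zero S
  here S⊑ = denotes (id , id) S⊑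

  there : ∀ {n} {σ : Vec Tree n} {s S Z} → Denotes σ s S → Denotes (Z ∷ σ) (suc s) S
  there (denotes v i) = denotes v i

  module _ {m n : ℕ} {ρ : Vec Word m} {σ : Vec Tree n} {s : Fin n}
           (S : NBTree) (dS : Denotes σ s (tree S)) where

    private
      subtree-correct : ∀ Z → Z ⊑ T₀ →
        ρ , Z ∷ σ ⊢ (root Z ≡ root (tree S) × Z ⊑ tree S) × NonBlocking Z ≈
                    rsubF zero (suc s) & nonBlockingF zero
      subtree-correct Z Z⊑ = &-correct (rsub-correct (here Z⊑) (there dS))
                                     (nonBlocking-correct (here Z⊑))

      below : ∀ T → T ⊑ʳ S → tree T ⊑ T₀
      below _ (_ , i) p = within dS (i p)

    module _ {P : ∀ T → T ⊑ʳ S → Set a} {φ : Monadic AP m (suc n)}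
             (e : ∀ T i {Z} → Denotes (Z ∷ σ) zero (tree T) → ρ , Z ∷ σ ⊢ P T i ≈ φ) where

      ∃ˢ-correct : ρ , σ ⊢ (∃[ T ] Σ[ i ∈ T ⊑ʳ S ] P T i) ≈ ∃ˢ s φ
      ∃ˢ-correct = ⟪ mk⇔
        (λ { (T , i , p) → tree T , below T i , tt ,
           to (iff (subtree-correct (tree T) (below T i))) (i , nonBlocking T) ,
           to (iff (e T i (here (below T i)))) p })
        (λ { (Z , Z⊑ , _ , r , p) → let i , nb = from (iff (subtree-correct Z Z⊑)) r in
           record { tree = Z ; nonBlocking = λ {τ} → nb {τ} } , i ,
           from (iff (e _ i (here Z⊑))) p }) ⟫

      ∀ˢ-correct : ρ , σ ⊢ (∀ T i → P T i) ≈ ∀ˢ s φ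
      ∀ˢ-correct = ⟪ mk⇔
        (λ { f (Z , Z⊑ , _ , ¬g) → ¬g λ { (r , ¬p) →
           let i , nb = from (iff (subtree-correct Z Z⊑)) r in
           ¬p (to (iff (e record { tree = Z ; nonBlocking = λ {τ} → nb {τ} } i
                         (here Z⊑))) (f _ i)) } })
        (λ h T i → from (iff (e T i (here (below T i)))) (by-contradiction λ ¬p →
           h (tree T , below T i , tt , λ g →
             g (to (iff (subtree-correct (tree T) (below T i))) (i , nonBlocking T) , ¬p)))) ⟫

    private
      infPath : ∀ T → T ⊑ʳ S → IsPath (tree T) → InfPath S
      infPath T i isp = record { path = T ; isPath = isp ; within = i }

    module _ {P : InfPath S → Set a} {φ : Monadic AP m (suc n)}
             (e : ∀ π {Z} → Denotes (Z ∷ σ) zero (tree (InfPath.path π)) →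
                  ρ , Z ∷ σ ⊢ P π ≈ φ) where

      ∃ᵖ-correct : ρ , σ ⊢ (Σ[ π ∈ InfPath S ] P π) ≈ ∃ᵖ s φ
      ∃ᵖ-correct = mk⇔ fwd bwd ⨾ ∃ˢ-correct {P = Q} λ T i dT →
        &-correctᵈ (path-correct dT) λ isp → e (infPath T i isp) dT
        where
        Q : ∀ T → T ⊑ʳ S → Set a
        Q T i = Σ (IsPath (tree T)) λ isp → P (infPath T i isp)

        fwd : Σ (InfPath S) P → ∃[ T ] Σ[ i ∈ T ⊑ʳ S ] Q T i
        fwd (π , p) = InfPath.path π , InfPath.within π , InfPath.isPath π , p

        bwd : (∃[ T ] Σ[ i ∈ T ⊑ʳ S ] Q T i) → Σ (InfPath S) P
        bwd (T , i , isp , p) = infPath T i isp , p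

      ∀ᵖ-correct : ρ , σ ⊢ (∀ π → P π) ≈ ∀ᵖ s φ
      ∀ᵖ-correct = mk⇔ fwd bwd ⨾ ∀ˢ-correct {P = Q} λ T i dT →
        ⇒-correctᵈ (path-correct dT) λ isp → e (infPath T i isp) dT
        where
        Q : ∀ T → T ⊑ʳ S → Set a
        Q T i = (isp : IsPath (tree T)) → P (infPath T i isp)

        fwd : (∀ π → P π) → ∀ T i → Q T i
        fwd f T i isp = f (infPath T i isp)

        bwd : (∀ T i → Q T i) → ∀ π → P π
        bwd f π = f (InfPath.path π) (InfPath.within π) (InfPath.isPath π)

  descendants-correct : ∀ {m n} {ρ : Vec Word m} {σ : Vec Tree n} {s t S T x} →
    Denotes σ s S → Denotes σ t (tree T) → (p : lookup ρ x ∈ nodes (tree T)) →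
    ρ , σ ⊢ nodes S ≐ nodes (tree (T at p)) ≈ descendantsF x s t
  descendants-correct dS dT p = mk⇔
      (λ (⊆T , T⊆) → (λ τ → ⊆T) , λ τ τ∈ x≼ → T⊆ (τ∈ , x≼))
      (λ (⊆T , T⊆) → (λ {τ} → ⊆T τ) , λ (τ∈ , x≼) → T⊆ _ τ∈ x≼)
    ⨾ &-correct (∀∈-correct dS λ _ → &-correct (∈-correct dT) ≼-correct)
        (∀∈-correct dT λ _ → ⇒-correct ≼-correct (∈-correct dS))

  -- `descendantsF` fixes the quantified tree up to `≐`, so this existential quantifier merely names
  -- `T at p`.
  ∃at-correct : ∀ {m n} {ρ : Vec Word m} {σ : Vec Tree n} {t x T} {P : Set a}
    {φ : Monadic AP m (suc n)} → Denotes σ t (tree T) → (p : lookup ρ x ∈ nodes (tree T)) →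
    (∀ {Z} → Denotes (Z ∷ σ) zero (tree (T at p)) → ρ , Z ∷ σ ⊢ P ≈ φ) →
    ρ , σ ⊢ P ≈ ∃² (descendantsF x zero (suc t) & φ)
  ∃at-correct {ρ = ρ} {x = x} {T} dT p e = ⟪ mk⇔
    (λ q → tree (T at p) , (λ {τ} → Tp⊑ {τ}) , tt ,
       to (iff (descendants-correct {ρ = ρ} {S = tree (T at p)} {T} {x} (here Tp⊑) (there dT) p))
         (id , id) ,
       to (iff (e (here Tp⊑))) q)
    (λ (Z , Z⊑ , _ , d , q) → from (iff (e (denotes
       (from (iff (descendants-correct {ρ = ρ} {S = Z} {T} {x} (here Z⊑) (there dT) p))
          d) Tp⊑))) q) ⟫
    where
    Tp⊑ : tree (T at p) ⊑ T₀
    Tp⊑ (q , _) = within dT q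

  module _ {T : NBTree} (π : InfPath T) {m n : ℕ} {ρ : Vec Word m} {σ : Vec Tree n} where

    module _ {z : Fin n} (dπ : Denotes σ z (tree (InfPath.path π)))
             {P : Pred ℕ a} {φ : Monadic AP (suc m) n}
             (e : ∀ i → pos π i ∷ ρ , σ ⊢ P i ≈ φ) where

      ∃pos-correct : ρ , σ ⊢ (∃[ i ] P i) ≈ ∃∈ z φ
      ∃pos-correct = ⟪ mk⇔ fwd bwd ⟫
        where
        fwd : (∃[ i ] P i) → ⟦ ∃∈ z φ ⟧ ρ σ
        fwd (i , p) = pos π i , within dπ i∈ , lift (proj₂ (value dπ) i∈) , to (iff (e i)) p
          where i∈ = proj₂ (InfPath.node π i)

        bwd : ⟦ ∃∈ z φ ⟧ ρ σ → ∃[ i ] P i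
        bwd (τ , _ , lift τ∈ , p) with pos-surjective π (proj₁ (value dπ) τ∈)
        ... | i , refl = i , from (iff (e i)) p

      ∀pos-correct : ρ , σ ⊢ (∀ i → P i) ≈ ∀∈ z φ
      -- `∀∈-correct` wants a predicate of nodes: a node is required to have the property for every
      -- position that it occupies, and `pos-surjective` supplies such a position.
      ∀pos-correct = mk⇔ (λ f τ τ∈ i _ → f i) (λ f i → f _ (proj₂ (InfPath.node π i)) i refl) ⨾
        ∀∈-correct dπ {P = λ τ → ∀ i → τ ≡ pos π i → P i} λ τ∈ → ⟪ mk⇔
          (λ f → let i , eq = pos-surjective π τ∈ in
                 subst (λ τ → ⟦ φ ⟧ (τ ∷ ρ) σ) (sym eq) (to (iff (e i)) (f i eq)))
          (λ { q i refl → from (iff (e i)) q }) ⟫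

    ≤-correct : ∀ {x y i j} → lookup ρ x ≡ pos π i → lookup ρ y ≡ pos π j →
                ρ , σ ⊢ i ≤ j ≈ x ≤′ y
    ≤-correct ex ey = mk⇔
        (λ i≤j → subst (_≼ _) (sym ex) (subst (_ ≼_) (sym ey) (pos-mono π i≤j)))
        (λ p → pos-cancel π (subst (_≼ _) ex (subst (_ ≼_) ey p)))
      ⨾ ≼-correct

    <-correct : ∀ {x y i j} → lookup ρ x ≡ pos π i → lookup ρ y ≡ pos π j →
                ρ , σ ⊢ i < j ≈ ¬′ (y ≤′ x)
    <-correct ex ey = mk⇔ <⇒≱ ≰⇒> ⨾ ¬-correct (≤-correct ey ex)

  mutual

    trS-correct : ∀ φ {m n} {ρ : Vec Word m} {σ : Vec Tree n} {s t} T⋆ T (i : T ⊑ʳ T⋆) →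
      Denotes σ s (tree T⋆) → Denotes σ t (tree T) → ρ , σ ⊢ models T⋆ T i φ ≈ trS φ s t
    trS-correct (atom p) T⋆ T i ds dt = atRoot-correct dt ⟪ mk⇔ id id ⟫
    trS-correct (¬ˢ φ) T⋆ T i ds dt = ¬-correct (trS-correct φ T⋆ T i ds dt)
    trS-correct (φ₁ ∧ˢ φ₂) T⋆ T i ds dt =
      &-correct (trS-correct φ₁ T⋆ T i ds dt) (trS-correct φ₂ T⋆ T i ds dt)
    trS-correct (φ₁ ∨ˢ φ₂) T⋆ T i ds dt =
      ⊕-correct (trS-correct φ₁ T⋆ T i ds dt) (trS-correct φ₂ T⋆ T i ds dt)
    trS-correct (φ₁ 𝕌[ ϕ ] φ₂) T⋆ T i ds dt =
      ∃ˢ-correct T⋆ ds λ T′ i′ d′ →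
      &-correct (strictSub-correct T′ T d′ (there dt) (trW-correct ϕ T⋆ T i (there ds) (there dt)))
      (&-correct (trS-correct φ₂ T⋆ T′ i′ (there ds) d′)
      (∀ˢ-correct T⋆ (there ds) λ T″ i″ d″ →
      ⇒-correct (strictSub-correct T′ T″ (there d′) d″
        (trW-correct ϕ T⋆ T i (there (there ds)) (there (there dt))))
      (⇒-correct (strictSub-correct T″ T d″ (there (there dt))
        (trW-correct ϕ T⋆ T i (there (there ds)) (there (there dt))))
      (trS-correct φ₁ T⋆ T″ i″ (there (there ds)) d″))))
    trS-correct (φ₁ ℝ[ ϕ ] φ₂) T⋆ T i ds dt =
      ∀ˢ-correct T⋆ ds λ T′ i′ d′ →
      ⇒-correct (strictSub-correct T′ T d′ (there dt) (trW-correct ϕ T⋆ T i (there ds) (there dt)))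
      (⊕-correct (trS-correct φ₂ T⋆ T′ i′ (there ds) d′)
      (∃ˢ-correct T⋆ (there ds) λ T″ i″ d″ →
      &-correct (strictSub-correct T′ T″ (there d′) d″
        (trW-correct ϕ T⋆ T i (there (there ds)) (there (there dt))))
      (&-correct (strictSub-correct T″ T d″ (there (there dt))
        (trW-correct ϕ T⋆ T i (there (there ds)) (there (there dt))))
      (trS-correct φ₁ T⋆ T″ i″ (there (there ds)) d″))))
    trS-correct (φ₁ 𝕊[ ϕ ] φ₂) T⋆ T i ds dt =
      ∃ˢ-correct T⋆ ds λ T′ i′ d′ →
      &-correct (strictSub-correct T T′ (there dt) d′ (trW-correct ϕ T⋆ T i (there ds) (there dt)))
      (&-correct (trS-correct φ₂ T⋆ T′ i′ (there ds) d′)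
      (∀ˢ-correct T⋆ (there ds) λ T″ i″ d″ →
      ⇒-correct (strictSub-correct T″ T′ d″ (there d′)
        (trW-correct ϕ T⋆ T i (there (there ds)) (there (there dt))))
      (⇒-correct (strictSub-correct T T″ (there (there dt)) d″
        (trW-correct ϕ T⋆ T i (there (there ds)) (there (there dt))))
      (trS-correct φ₁ T⋆ T″ i″ (there (there ds)) d″))))
    trS-correct (φ₁ 𝔹[ ϕ ] φ₂) T⋆ T i ds dt =
      ∀ˢ-correct T⋆ ds λ T′ i′ d′ →
      ⇒-correct (strictSub-correct T T′ (there dt) d′ (trW-correct ϕ T⋆ T i (there ds) (there dt)))
      (⊕-correct (trS-correct φ₂ T⋆ T′ i′ (there ds) d′)
      (∃ˢ-correct T⋆ (there ds) λ T″ i″ d″ →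
      &-correct (strictSub-correct T″ T′ d″ (there d′)
        (trW-correct ϕ T⋆ T i (there (there ds)) (there (there dt))))
      (&-correct (strictSub-correct T T″ (there (there dt)) d″
        (trW-correct ϕ T⋆ T i (there (there ds)) (there (there dt))))
      (trS-correct φ₁ T⋆ T″ i″ (there (there ds)) d″))))
    trS-correct (E ψ) T⋆ T i ds dt = ∃ᵖ-correct T dt λ π dπ →
      atRoot-correct dπ (trP-correct ψ T⋆ T i (there ds) (there dt) π dπ refl)
    trS-correct (A ψ) T⋆ T i ds dt = ∀ᵖ-correct T dt λ π dπ →
      atRoot-correct dπ (trP-correct ψ T⋆ T i (there ds) (there dt) π dπ refl)

    trAt-correct : ∀ φ {m n} {ρ : Vec Word m} {σ : Vec Tree n} {s t x τ} T⋆ T (i : T ⊑ʳ T⋆) →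
      Denotes σ s (tree T⋆) → Denotes σ t (tree T) →
      lookup ρ x ≡ τ → (p : τ ∈ nodes (tree T)) →
      ρ , σ ⊢ models (T⋆ at proj₂ i p) (T at p) (at-mono {T} {T⋆} i p) φ ≈ trAt φ s t x
    trAt-correct φ T⋆ T i ds dt refl p =
      ∃at-correct {T = T⋆} ds (proj₂ i p) λ ds′ →
      ∃at-correct {T = T} (there dt) p λ dt′ →
      trS-correct φ (T⋆ at proj₂ i p) (T at p) (at-mono {T} {T⋆} i p) (there ds′) dt′

    trW-correct : ∀ ϕ {m n} {ρ : Vec Word m} {σ : Vec Tree n} {s t} T⋆ T (i : T ⊑ʳ T⋆) →
      Denotes σ s (tree T⋆) → Denotes σ t (tree T) → ∀ {τ} → τ ∈ nodes T₀ →
      τ ∷ ρ , σ ⊢ extension T⋆ T i ϕ τ ≈ trW ϕ s t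
    trW-correct ϕ T⋆ T i ds dt _ =
      &-correctᵈ (∈-correct dt) λ p → trAt-correct ϕ T⋆ T i ds dt refl p

    trP-correct : ∀ ψ {m n} {ρ : Vec Word m} {σ : Vec Tree n} {s t z x k} T⋆ T (i : T ⊑ʳ T⋆) →
      Denotes σ s (tree T⋆) → Denotes σ t (tree T) →
      (π : InfPath T) → Denotes σ z (tree (InfPath.path π)) → lookup ρ x ≡ pos π k →
      ρ , σ ⊢ holds T⋆ T i π k ψ ≈ trP ψ s t z x
    trP-correct (state φ) {k = k} T⋆ T i ds dt π dπ eq =
      trAt-correct φ T⋆ T i ds dt eq (InfPath.node∈ π k)
    trP-correct (¬ᵖ ψ) T⋆ T i ds dt π dπ eq = ¬-correct (trP-correct ψ T⋆ T i ds dt π dπ eq)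
    trP-correct (ψ₁ ∧ᵖ ψ₂) T⋆ T i ds dt π dπ eq =
      &-correct (trP-correct ψ₁ T⋆ T i ds dt π dπ eq) (trP-correct ψ₂ T⋆ T i ds dt π dπ eq)
    trP-correct (ψ₁ ∨ᵖ ψ₂) T⋆ T i ds dt π dπ eq =
      ⊕-correct (trP-correct ψ₁ T⋆ T i ds dt π dπ eq) (trP-correct ψ₂ T⋆ T i ds dt π dπ eq)
    -- `X ψ` becomes a child step within the path variable; by `pos-child` the child on the path can
    -- only be at position `suc k`.
    trP-correct (X ψ) {ρ = ρ} {x = x} {k} T⋆ T i ds dt π dπ eq = mk⇔ fwd bwd ⨾
      ∃pos-correct π dπ λ j → &-correct
        (child-correct (subst (nodes T₀) (sym eq) (∈T₀ k)) (∈T₀ j))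
        (trP-correct ψ T⋆ T i ds dt π dπ refl)
      where
      ∈T₀ : ∀ j → pos π j ∈ nodes T₀
      ∈T₀ j = within dt (InfPath.node∈ π j)

      fwd : holds T⋆ T i π (suc k) ψ →
            ∃[ j ] ((∃[ l ] pos π j ≡ lookup ρ x ∷ʳ l) × holds T⋆ T i π j ψ)
      fwd h = suc k , (next , cong (_∷ʳ next) (sym eq)) , h
        where
        next : ℕ
        next = proj₁ (nonBlocking (InfPath.path π) (proj₂ (InfPath.node π k)))

      bwd : (∃[ j ] ((∃[ l ] pos π j ≡ lookup ρ x ∷ʳ l) × holds T⋆ T i π j ψ)) →
            holds T⋆ T i π (suc k) ψ
      bwd (j , (l , e) , h) = subst (λ j → holds T⋆ T i π j ψ)
        (pos-child π (trans e (cong (_∷ʳ l) eq))) h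
    trP-correct (ψ₁ U ψ₂) T⋆ T i ds dt π dπ eq =
      ∃pos-correct π dπ λ j → &-correct (≤-correct π eq refl)
      (&-correct (trP-correct ψ₂ T⋆ T i ds dt π dπ refl)
      (∀pos-correct π dπ λ k → ⇒-correct (≤-correct π eq refl)
      (⇒-correct (<-correct π refl refl) (trP-correct ψ₁ T⋆ T i ds dt π dπ refl))))
    trP-correct (ψ₁ R ψ₂) T⋆ T i ds dt π dπ eq =
      ∀pos-correct π dπ λ j → ⇒-correct (≤-correct π eq refl)
      (⊕-correct (trP-correct ψ₂ T⋆ T i ds dt π dπ refl)
      (∃pos-correct π dπ λ k → &-correct (≤-correct π eq refl)
      (&-correct (<-correct π refl refl) (trP-correct ψ₁ T⋆ T i ds dt π dπ refl))))

  sentence-correct : ∀ φ → Sat STL* 𝒯 φ ⇔ Sat MTL 𝒯 (sentence φ)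
  sentence-correct φ = mk⇔
    (λ p → T₀ , (λ {_} → id) , tt , to (iff (whole T₀ (here id))) (λ _ τ∈ → τ∈) ,
           to (iff (trS₀ T₀ (here id))) p)
    (λ (Z , Z⊑ , _ , w , p) → from (iff (trS₀ Z (denotes
       (Z⊑ , λ {τ} → from (iff (whole Z (here Z⊑))) w τ) id))) p)
    where
    T⋆ = carrier 𝒯

    whole : ∀ Z → Denotes (Z ∷ []) zero Z →
            [] , Z ∷ [] ⊢ (∀ τ → τ ∈ nodes T₀ → τ ∈ nodes Z) ≈ ∀¹ (zero ∈′ zero)
    whole Z d = ∀¹-correct λ _ → ∈-correct d

    trS₀ : ∀ Z → Denotes (Z ∷ []) zero T₀ →
           [] , Z ∷ [] ⊢ Sat STL* 𝒯 φ ≈ trS φ zero zero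
    trS₀ Z d = trS-correct φ T⋆ T⋆ (⊑ʳ-refl {T⋆}) d d

STL*≤MTL : ExcludedMiddle (lsuc 0ℓ) → STL* ≤ᴸ MTL
STL*≤MTL em AP _ φ = sentence φ , λ 𝒯 → TranslationCorrect.sentence-correct em 𝒯 φ

-- The comb

-- The i-th node of the spine for j = 0, and the j-th node of the tooth
-- attached to it otherwise.
cell : ℕ → ℕ → Word
cell i j = replicate i 0 ++ replicate j 1

infix 4 _⊴_

-- The prefix order in coordinates: one climbs within a single tooth, or starts on the spine
-- (`j ≡ 0`) and reaches every cell at the same or a later spine index.
_⊴_ : ℕ × ℕ → ℕ × ℕ → Set
(i , j) ⊴ (k , l) = (i ≡ k × j ≤ l) ⊎ (i ≤ k × j ≡ 0)

⊴-refl : (i , j) ⊴ (i , j)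
⊴-refl = inj₁ (refl , ≤-refl)

replicate-∷ʳ : ∀ n {x : ℕ} → replicate n x ∷ʳ x ≡ replicate (suc n) x
replicate-∷ʳ zero    = refl
replicate-∷ʳ (suc n) = cong (_ ∷_) (replicate-∷ʳ n)

cell-tooth : ∀ i j → cell i j ∷ʳ 1 ≡ cell i (suc j)
cell-tooth i j = trans (++-assoc (replicate i 0) _ _) (cong (replicate i 0 ++_) (replicate-∷ʳ j))

cell-spine : ∀ i → cell i 0 ∷ʳ 0 ≡ cell (suc i) 0
cell-spine zero    = refl
cell-spine (suc i) = cong (0 ∷_) (cell-spine i)

length-cell : ∀ i j → length (cell i j) ≡ i + j
length-cell i j = trans (length-++ (replicate i 0))
  (cong₂ _+_ (length-replicate i) (length-replicate j))

cell-injective : ∀ i k → cell i j ≡ cell k l → i ≡ k × j ≡ l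
cell-injective {j} {l} zero zero eq =
  refl , trans (sym (length-cell 0 j)) (trans (cong length eq) (length-cell 0 l))
cell-injective {suc j} zero (suc k) ()
cell-injective {l = suc l} (suc i) zero ()
cell-injective (suc i) (suc k) eq with cell-injective i k (∷-injectiveʳ eq)
... | refl , refl = refl , refl

⊴⇒≼ : ∀ i j k l → (i , j) ⊴ (k , l) → cell i j ≼ cell k l
⊴⇒≼ zero    zero    k       l       _                      = _ , refl
⊴⇒≼ zero    (suc j) zero    (suc l) (inj₁ (_ , s≤s j≤l)) =
  let υ , eq = ⊴⇒≼ zero j zero l (inj₁ (refl , j≤l)) in υ , cong (1 ∷_) eq
⊴⇒≼ (suc i) j       (suc .i) l      (inj₁ (refl , j≤l)) =
  let υ , eq = ⊴⇒≼ i j i l (inj₁ (refl , j≤l)) in υ , cong (0 ∷_) eq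
⊴⇒≼ (suc i) j       (suc k) l       (inj₂ (s≤s i≤k , j≡0)) =
  let υ , eq = ⊴⇒≼ i j k l (inj₂ (i≤k , j≡0)) in υ , cong (0 ∷_) eq

≼-cell⁻ : ∀ {τ} k l → τ ≼ cell k l → ∃[ i ] ∃[ j ] (τ ≡ cell i j × (i , j) ⊴ (k , l))
≼-cell⁻ {[]}    k       l       _          = 0 , 0 , refl , inj₂ (z≤n , refl)
≼-cell⁻ {x ∷ τ} zero    zero    (_ , ())
≼-cell⁻ {x ∷ τ} zero    (suc l) (υ , eq) with refl ← ∷-injectiveˡ eq
  with ≼-cell⁻ {τ} zero l (υ , ∷-injectiveʳ eq)
... | zero , j , refl , inj₁ (_ , j≤l)  = 0 , suc j , refl , inj₁ (refl , s≤s j≤l)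
... | zero , j , refl , inj₂ (_ , refl) = 0 , 1 , refl , inj₁ (refl , s≤s z≤n)
≼-cell⁻ {x ∷ τ} (suc k) l       (υ , eq) with refl ← ∷-injectiveˡ eq
  with ≼-cell⁻ {τ} k l (υ , ∷-injectiveʳ eq)
... | i , j , refl , inj₁ (i≡k , j≤l)  = suc i , j , refl , inj₁ (cong suc i≡k , j≤l)
... | i , j , refl , inj₂ (i≤k , j≡0) = suc i , j , refl , inj₂ (s≤s i≤k , j≡0)

≼⇒⊴ : ∀ i k → cell i j ≼ cell k l → (i , j) ⊴ (k , l)
≼⇒⊴ {j} {l} i k p with ≼-cell⁻ k l p
... | i′ , j′ , eq , q with cell-injective i i′ eq
... | refl , refl = q

module _ (Q : ℕ → ℕ → Set) (Q-closed : ∀ {i j k l} → (i , j) ⊴ (k , l) → Q k l → Q i j)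
         (i j : ℕ) (q : Q i j) where

  -- A downward closed set of cells, cut off at a root. The comb, its paths and the comb with the
  -- odd teeth removed are all instances.
  subcomb : Tree
  subcomb = record
    { nodes  = λ τ → ∃[ k ] ∃[ l ] (τ ≡ cell k l × (i , j) ⊴ (k , l) × Q k l)
    ; root   = cell i j
    ; isTree = record
      { root∈  = i , j , refl , ⊴-refl , q
      ; rooted = λ { (k , l , refl , p , _) → ⊴⇒≼ i j k l p }
      ; closed = closed
      }
    }
    where
    closed : ∀ {τ τ′} → ∃[ k ] ∃[ l ] (cell i j ++ τ ≡ cell k l × (i , j) ⊴ (k , l) × Q k l) →
             τ′ ≼ τ → ∃[ k ] ∃[ l ] (cell i j ++ τ′ ≡ cell k l × (i , j) ⊴ (k , l) × Q k l)
    closed {τ′ = τ′} (k , l , eq , _ , q) (υ , refl)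
      with ≼-cell⁻ k l (υ , trans (sym eq) (sym (++-assoc (cell i j) τ′ υ)))
    ... | k′ , l′ , eq′ , p = k′ , l′ , eq′ , ≼⇒⊴ i k′ (τ′ , sym eq′) , Q-closed p q

  cell∈subcomb : cell k l ∈ nodes subcomb ⇔ ((i , j) ⊴ (k , l) × Q k l)
  cell∈subcomb {k} {l} = mk⇔ fwd λ (p , q) → k , l , refl , p , q
    where
    fwd : cell k l ∈ nodes subcomb → (i , j) ⊴ (k , l) × Q k l
    fwd (k′ , l′ , eq , p) with cell-injective k k′ eq
    ... | refl , refl = p

  subcomb-nonBlocking :
    (∀ {k l} → (i , j) ⊴ (k , l) → Q k l → Q k (suc l) ⊎ (l ≡ 0 × Q (suc k) 0)) →
    NonBlocking subcomb
  subcomb-nonBlocking next (k , l , refl , p , q) with next p q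
  ... | inj₁ q′ = 1 , k , suc l , cell-tooth k l , down , q′
    where
    down : (i , j) ⊴ (k , suc l)
    down = ≼⇒⊴ i k (≼-trans (⊴⇒≼ i j k l p) (_ , sym (cell-tooth k l)))
  ... | inj₂ (refl , q′) = 0 , suc k , 0 , cell-spine k , down , q′
    where
    down : (i , j) ⊴ (suc k , 0)
    down = ≼⇒⊴ i (suc k) (≼-trans (⊴⇒≼ i j k 0 p) (_ , sym (cell-spine k)))

comb : NBTree
comb = record
  { tree        = subcomb (λ _ _ → ⊤) _ 0 0 tt
  ; nonBlocking = subcomb-nonBlocking _ _ 0 0 tt λ _ _ → inj₁ tt
  }

cell∈comb : ∀ i j → cell i j ∈ nodes (tree comb)
cell∈comb i j = i , j , refl , inj₂ (z≤n , refl) , tt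

subcomb⊑comb : ∀ Q (Q-closed : ∀ {i j k l} → (i , j) ⊴ (k , l) → Q k l → Q i j) i j q →
               subcomb Q Q-closed i j q ⊑ tree comb
subcomb⊑comb _ _ _ _ _ (k , l , refl , _) = cell∈comb k l

-- Paths of the comb

-- nothing stands for ∞.
infix 4 _≤∞_

_≤∞_ : ℕ → Maybe ℕ → Set
i ≤∞ nothing = ⊤
i ≤∞ just k  = i ≤ k

≤∞-trans : i ≤ k → k ≤∞ I → i ≤∞ I
≤∞-trans {I = nothing} _ _ = tt
≤∞-trans {I = just _} p q = ≤-trans p q

-- The cells on the way to an end: the spine up to index `I`, then the tooth at `I` up to height
-- `J`. With `I` infinite no tooth is entered, as `I ≡ just i` fails.
Upto : Maybe ℕ → Maybe ℕ → ℕ → ℕ → Set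
Upto I J i j = i ≤∞ I × (j ≡ 0 ⊎ (I ≡ just i × j ≤∞ J))

Upto-closed : (i , j) ⊴ (k , l) → Upto I J k l → Upto I J i j
Upto-closed (inj₁ (refl , z≤n)) (p , inj₁ refl)     = p , inj₁ refl
Upto-closed {J = J} (inj₁ (refl , j≤l)) (p , inj₂ (e , r)) = p , inj₂ (e , ≤∞-trans {I = J} j≤l r)
Upto-closed {I = I} (inj₂ (i≤k , refl)) (p , _)            = ≤∞-trans {I = I} i≤k p , inj₁ refl

Upto-total : Upto I J i j → Upto I J k l → (i , j) ⊴ (k , l) ⊎ (k , l) ⊴ (i , j)
Upto-total {i = i} {k = k} (_ , inj₁ refl) (_ , inj₁ refl) with ≤-total i k
... | inj₁ i≤k = inj₁ (inj₂ (i≤k , refl))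
... | inj₂ k≤i = inj₂ (inj₂ (k≤i , refl))
Upto-total (i≤k , inj₁ refl) (_ , inj₂ (refl , _)) = inj₁ (inj₂ (i≤k , refl))
Upto-total (_ , inj₂ (refl , _)) (k≤i , inj₁ refl) = inj₂ (inj₂ (k≤i , refl))
Upto-total {j = j} {l = l} (_ , inj₂ (refl , _)) (_ , inj₂ (refl , _)) with ≤-total j l
... | inj₁ j≤l = inj₁ (inj₁ (refl , j≤l))
... | inj₂ l≤j = inj₂ (inj₁ (refl , l≤j))

pathcomb : ∀ I J i j → Upto I J i j → Tree
pathcomb I J = subcomb (Upto I J) (Upto-closed {I = I} {J})

pathcomb⊑comb : ∀ I J i j p → pathcomb I J i j p ⊑ tree comb
pathcomb⊑comb I J i j p = subcomb⊑comb (Upto I J) (Upto-closed {I = I} {J}) i j p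

-- Any two cells in `Upto` are comparable, and comparable children of one node coincide.
pathcomb-isPath : ∀ {p} → IsPath (pathcomb I J i j p)
pathcomb-isPath {I} {J} {i} {j} {τ = τ} _ (k , l , e , _ , p) (k′ , l′ , e′ , _ , p′)
  with Upto-total {I} {J} p p′
... | inj₁ q = ∷ʳ-≼⁻ (subst (_≼ _) (sym e) (subst (_ ≼_) (sym e′) (⊴⇒≼ k l k′ l′ q)))
... | inj₂ q = sym (∷ʳ-≼⁻ (subst (_≼ _) (sym e′) (subst (_ ≼_) (sym e) (⊴⇒≼ k′ l′ k l q))))

-- Both words are read in parallel from the root: while neither is exhausted, their next letters
-- give two children of the same node, hence agree.
path-total : ∀ S → IsPath S → ∀ {σ τ} → σ ∈ nodes S → τ ∈ nodes S → σ ≼ τ ⊎ τ ≼ σ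
path-total S path σ∈ τ∈ with root≼ S σ∈ | root≼ S τ∈
... | υ , refl | ω , refl = go (root S) υ ω (root∈ S) σ∈ τ∈
  where
  go : ∀ ρ υ ω → ρ ∈ nodes S → ρ ++ υ ∈ nodes S → ρ ++ ω ∈ nodes S →
       ρ ++ υ ≼ ρ ++ ω ⊎ ρ ++ ω ≼ ρ ++ υ
  go ρ []      ω       _  _  _  = inj₁ (ω , cong (_++ ω) (sym (++-identityʳ ρ)))
  go ρ (x ∷ υ) []      _  _  _  = inj₂ (x ∷ υ , cong (_++ x ∷ υ) (sym (++-identityʳ ρ)))
  go ρ (x ∷ υ) (y ∷ ω) ρ∈ p q
    with x∈ ← convex S ρ∈ p ≼-∷ʳ (υ , sym (++-assoc ρ _ υ))
    with refl ← path ρ∈ x∈ (convex S ρ∈ q ≼-∷ʳ (ω , sym (++-assoc ρ _ ω)))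
    rewrite sym (++-assoc ρ (x ∷ []) υ) | sym (++-assoc ρ (x ∷ []) ω)
    = go (ρ ∷ʳ x) υ ω x∈ p q

-- Among the cells, `S` has the same members as a `pathcomb`. Subtrees of the comb have no other
-- nodes, and no equality of trees has to be produced.
record Shape (S : Tree) (i j : ℕ) (I J : Maybe ℕ) : Set where
  field
    start : Upto I J i j
    cell∈ : ∀ k l → cell k l ∈ nodes S ⇔ ((i , j) ⊴ (k , l) × Upto I J k l)

pathcomb-shape : ∀ {p} → Shape (pathcomb I J i j p) i j I J
pathcomb-shape {I} {J} {i} {j} {p} = record
  { start = p ; cell∈ = λ k l → cell∈subcomb (Upto I J) (Upto-closed {I = I} {J}) i j p }

module _ (em : ExcludedMiddle (lsuc 0ℓ)) where

  em₀ : (P : Set) → Dec P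
  em₀ P with em {Lift _ P}
  ... | yes (lift p) = yes p
  ... | no ¬p        = no (¬p ∘ lift)

  -- Either `P` fails right after some index where it holds, which then is the bound, or it holds
  -- everywhere and the bound is `nothing`.
  supremum : (P : Pred ℕ 0ℓ) → P 0 → (∀ {i k} → i ≤ k → P k → P i) →
             ∃[ I ] (∀ i → P i ⇔ i ≤∞ I)
  supremum P p₀ down with em₀ (∃[ i ] (P i × ¬ P (suc i)))
  ... | yes (i , p , ¬p) = just i , λ k → mk⇔
          (λ pk → ≮⇒≥ λ i<k → ¬p (down i<k pk)) (λ k≤i → down k≤i p)
  ... | no ¬last = nothing , λ k → mk⇔ (λ _ → tt) (λ _ → all k)
    where
    all : ∀ k → P k
    all zero    = p₀
    all (suc k) with em₀ (P (suc k))
    ... | yes p = p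
    ... | no ¬p = contradiction (k , all k , ¬p) ¬last

  -- The end has as coordinates the suprema of the coordinates of all nodes. They describe the path
  -- because it can leave the spine only once: a tooth that it enters lies at the largest spine
  -- index.
  path-shape : ∀ S → S ⊑ tree comb → IsPath S → ∃[ i ] ∃[ j ] ∃[ I ] ∃[ J ] Shape S i j I J
  path-shape S S⊑ path with S⊑ (root∈ S)
  ... | i₀ , j₀ , root≡ , _ = i₀ , j₀ , I∞ , J∞ , record
    { start = upto i₀ j₀ (subst (nodes S) root≡ (root∈ S))
    ; cell∈ = λ k l → mk⇔ (λ p → above k l p , upto k l p) (λ (p , q) → reach k l p q)
    }
    where
    above : ∀ k l → cell k l ∈ nodes S → (i₀ , j₀) ⊴ (k , l)
    above k l p = ≼⇒⊴ i₀ k (subst (_≼ _) root≡ (root≼ S p))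

    between : ∀ k l k′ l′ → (i₀ , j₀) ⊴ (k , l) → (k , l) ⊴ (k′ , l′) →
              cell k′ l′ ∈ nodes S → cell k l ∈ nodes S
    between k l k′ l′ p q r = convex S (root∈ S) r
      (subst (_≼ _) (sym root≡) (⊴⇒≼ i₀ j₀ k l p)) (⊴⇒≼ k l k′ l′ q)

    supI = supremum (λ i → ∃[ k ] ∃[ l ] (i ≤ k × cell k l ∈ nodes S))
      (i₀ , j₀ , z≤n , subst (nodes S) root≡ (root∈ S))
      (λ i≤k (k , l , p , q) → k , l , ≤-trans i≤k p , q)
    supJ = supremum (λ j → ∃[ k ] ∃[ l ] (j ≤ l × cell k l ∈ nodes S))
      (i₀ , j₀ , z≤n , subst (nodes S) root≡ (root∈ S))
      (λ j≤l (k , l , p , q) → k , l , ≤-trans j≤l p , q)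
    I∞ = proj₁ supI
    J∞ = proj₁ supJ

    -- A tooth cell is a prefix only of cells of the same tooth, so a comparable cell cannot lie
    -- further along the spine.
    tooth-last : ∀ {k l k′ l′} → cell k (suc l) ∈ nodes S → cell k′ l′ ∈ nodes S → k′ ≤ k
    tooth-last {k} {l} {k′} {l′} p q with path-total S path p q
    ... | inj₁ p≼q with ≼⇒⊴ k k′ p≼q
    ...   | inj₁ (refl , _) = ≤-refl
    tooth-last {k} {l} {k′} {l′} p q | inj₂ q≼p with ≼⇒⊴ k′ k q≼p
    ...   | inj₁ (refl , _) = ≤-refl
    ...   | inj₂ (k′≤k , _) = k′≤k

    I-tooth : ∀ {k l} → cell k (suc l) ∈ nodes S → I∞ ≡ just k
    I-tooth {k} {l} p with I∞ | proj₂ supI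
    ... | nothing | sup = let k′ , l′ , k<k′ , q = from (sup (suc k)) tt in
                          contradiction (tooth-last p q) (<⇒≱ k<k′)
    ... | just i  | sup = let k′ , l′ , i≤k′ , q = from (sup i) ≤-refl in
                          cong just (≤-antisym (≤-trans i≤k′ (tooth-last p q))
                                               (to (sup k) (k , suc l , ≤-refl , p)))

    upto : ∀ k l → cell k l ∈ nodes S → Upto I∞ J∞ k l
    upto k zero    p = to (proj₂ supI k) (k , 0 , ≤-refl , p) , inj₁ refl
    upto k (suc l) p = to (proj₂ supI k) (k , suc l , ≤-refl , p) ,
                       inj₂ (I-tooth p , to (proj₂ supJ (suc l)) (k , suc l , ≤-refl , p))

    reach : ∀ k l → (i₀ , j₀) ⊴ (k , l) → Upto I∞ J∞ k l → cell k l ∈ nodes S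
    reach k .0 p (k≤I∞ , inj₁ refl) =
      let k′ , l′ , k≤k′ , q = from (proj₂ supI k) k≤I∞ in
      between k 0 k′ l′ p (inj₂ (k≤k′ , refl)) q
    reach k zero p (k≤I∞ , inj₂ _) = reach k zero p (k≤I∞ , inj₁ refl)
    -- The node witnessing the height might lie in another tooth `k′`; `I-tooth` identifies the two
    -- teeth through `I∞`.
    reach k (suc l) p (_ , inj₂ (I∞≡ , l≤J∞)) with from (proj₂ supJ (suc l)) l≤J∞
    ... | k′ , suc l′ , l≤l′ , q with trans (sym I∞≡) (I-tooth q)
    ... | refl = between k (suc l) k (suc l′) p (inj₁ (refl , l≤l′)) q

-- The back-and-forth argument

tail mark : Bool
tail = true
mark = false

combLab : ℕ → Word → Pred Bool 0ℓ
combLab n τ true  = ∃[ i ] ∃[ j ] τ ≡ cell i (suc j)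
combLab n τ false = τ ≡ cell n 0

𝒞 : ℕ → KripkeTree Bool
𝒞 n = record { carrier = comb ; lab = combLab n }

-- The partial isomorphism of (ℕ, ≤) that inserts a new point at c, restricted
-- to the numbers at distance at least d from c.
Shift : ℕ → ℕ → ℕ → ℕ → Set
Shift d c x y = (x + d ≤ c × y ≡ x) ⊎ (c + d ≤ x × y ≡ suc x)

Shift-weaken : ∀ {d e c x y} → d ≤ e → Shift e c x y → Shift d c x y
Shift-weaken {x = x} d≤e (inj₁ (p , q)) = inj₁ (≤-trans (+-monoʳ-≤ x d≤e) p , q)
Shift-weaken {c = c} d≤e (inj₂ (p , q)) = inj₂ (≤-trans (+-monoʳ-≤ c d≤e) p , q)

-- Moving the centre by `d`, here up and in `Shift-down` down, costs each point at most `d` of its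
-- distance, so half of the margin survives on both sides.
Shift-up : ∀ {d c x y} → Shift (d + d) c x y → Shift d (c + d) x y
Shift-up {d} {c} {x} (inj₁ (p , q)) =
  inj₁ (≤-trans (+-monoʳ-≤ x (m≤m+n d d)) (≤-trans p (m≤m+n c d)) , q)
Shift-up {d} {c} {x} (inj₂ (p , q)) = inj₂ (subst (_≤ x) (sym (+-assoc c d d)) p , q)

Shift-down : ∀ {d c x y} → d ≤ c → Shift (d + d) c x y → Shift d (c ∸ d) x y
Shift-down {d} {c} {x} d≤c (inj₁ (p , q)) =
  inj₁ (m+n≤o⇒m≤o∸n (x + d) (subst (_≤ c) (sym (+-assoc x d d)) p) , q)
Shift-down {d} {c} {x} d≤c (inj₂ (p , q)) =
  inj₂ (≤-trans (≤-reflexive (m∸n+n≡m d≤c)) (≤-trans (m≤m+n c (d + d)) p) , q)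

-- A positive margin separates the two branches; at distance 0 the centre would be related both to
-- itself and to its successor.
Shift-≤ : ∀ {d c x y x′ y′} → 1 ≤ d → Shift d c x y → Shift d c x′ y′ → x ≤ x′ ⇔ y ≤ y′
Shift-≤ 1≤d (inj₁ (_ , refl)) (inj₁ (_ , refl)) = mk⇔ id id
Shift-≤ 1≤d (inj₂ (_ , refl)) (inj₂ (_ , refl)) = mk⇔ s≤s s≤s⁻¹
Shift-≤ {d} {c} {x} {x′ = x′} 1≤d (inj₁ (p , refl)) (inj₂ (q , refl)) =
  mk⇔ (λ _ → m≤n⇒m≤1+n x≤x′) (λ _ → x≤x′)
  where
  x≤x′ : x ≤ x′
  x≤x′ = ≤-trans (m≤m+n x d) (≤-trans p (≤-trans (m≤m+n c d) q))
Shift-≤ {d} {c} {x} {x′ = x′} 1≤d (inj₂ (p , refl)) (inj₁ (q , refl)) =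
  mk⇔ (λ x≤x′ → contradiction x≤x′ (<⇒≱ x′<x))
      (λ x<x′ → contradiction (<⇒≤ x<x′) (<⇒≱ x′<x))
  where
  x′<x : x′ < x
  x′<x = ≤-trans (≤-trans (≤-reflexive (+-comm 1 x′)) (+-monoʳ-≤ x′ 1≤d))
                 (≤-trans q (≤-trans (m≤m+n c d) p))

-- One round of the game: the new pair joins the relation, the old pairs stay, the margin is halved.
-- `d≤` leaves room below the centre for later rounds.
record Move (d c x y : ℕ) : Set where
  field
    centre  : ℕ
    d≤      : d ≤ centre
    related : Shift d centre x y
    extends : ∀ {u v} → Shift (d + d) c u v → Shift d centre u v

module _ {d c : ℕ} (2d≤c : d + d ≤ c) where

  private
    d≤c : d ≤ c
    d≤c = ≤-trans (m≤m+n d d) 2d≤c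

  -- A point close to the centre is moved away from it by moving the centre
  -- to its other side.
  move-below : ∀ {x} → x ≤ c → Move d c x x
  move-below x≤c = record
    { centre  = c + d
    ; d≤      = m≤n+m d c
    ; related = inj₁ (+-monoˡ-≤ d x≤c , refl)
    ; extends = Shift-up
    }

  move-above : ∀ {x} → c ≤ x → Move d c x (suc x)
  move-above c≤x = record
    { centre  = c ∸ d
    ; d≤      = m+n≤o⇒m≤o∸n d 2d≤c
    ; related = inj₂ (≤-trans (≤-reflexive (m∸n+n≡m d≤c)) c≤x , refl)
    ; extends = Shift-down d≤c
    }

  forth : ∀ x → ∃[ y ] Move d c x y
  forth x with ≤-total x c
  ... | inj₁ x≤c = x , move-below x≤c
  ... | inj₂ c≤x = suc x , move-above c≤x

  back : ∀ y → ∃[ x ] Move d c x y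
  back y with y ≤? c
  ... | yes y≤c = y , move-below y≤c
  back zero    | no y≰c = contradiction z≤n y≰c
  back (suc x) | no y≰c = x , move-above (s≤s⁻¹ (≰⇒> y≰c))

record Move∞ (d c : ℕ) (I I′ : Maybe ℕ) : Set where
  field
    centre  : ℕ
    d≤      : d ≤ centre
    related : Pointwise (Shift d centre) I I′
    extends : ∀ {u v} → Shift (d + d) c u v → Shift d centre u v

module _ {d c : ℕ} (2d≤c : d + d ≤ c) where

  private
    finite : ∀ {x y} → Move d c x y → Move∞ d c (just x) (just y)
    finite v = record { Move v ; related = just (Move.related v) }

    infinite : Move∞ d c nothing nothing
    -- An infinite end chooses no point; a move for the centre itself is made to obtain a new centre
    -- with half the margin.
    infinite = record { Move (move-below {d} {c} 2d≤c ≤-refl) ; related = nothing }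

  forth∞ : ∀ I → ∃[ I′ ] Move∞ d c I I′
  forth∞ nothing  = nothing , infinite
  forth∞ (just x) = let y , v = forth 2d≤c x in just y , finite v

  back∞ : ∀ I′ → ∃[ I ] Move∞ d c I I′
  back∞ nothing  = nothing , infinite
  back∞ (just y) = let x , v = back 2d≤c y in just x , finite v

-- Only the spine index is shifted; the height `j` in the tooth is copied, and likewise `J` in
-- `Paths`.
data Cells (Q : ℕ → ℕ → Set) : Word → Word → Set where
  cells : ∀ {i i′} j → Q i i′ → Cells Q (cell i j) (cell i′ j)

data Paths (Q : ℕ → ℕ → Set) (S S′ : Tree) : Set where
  paths : ∀ {i i′ j I I′ J} → Q i i′ → Pointwise Q I I′ →
          Shape S i j I J → Shape S′ i′ j I′ J → Paths Q S S′

module _ {Q Q′ : ℕ → ℕ → Set} (Q⊆Q′ : ∀ {x y} → Q x y → Q′ x y) where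

  Cells-map : ∀ {τ τ′} → Cells Q τ τ′ → Cells Q′ τ τ′
  Cells-map (cells j r) = cells j (Q⊆Q′ r)

  Pointwise-map : Pointwise Q I I′ → Pointwise Q′ I I′
  Pointwise-map nothing  = nothing
  Pointwise-map (just r) = just (Q⊆Q′ r)

  Paths-map : ∀ {S S′} → Paths Q S S′ → Paths Q′ S S′
  Paths-map (paths r r∞ s s′) = paths (Q⊆Q′ r) (Pointwise-map r∞) s s′

-- Atomic formulas under order embeddings of the spine

module OrderEmbedding {Q : ℕ → ℕ → Set}
  (Q-≤ : ∀ {x y x′ y′} → Q x y → Q x′ y′ → x ≤ x′ ⇔ y ≤ y′) where

  Q-≡ : Q i i′ → Q k k′ → i ≡ k ⇔ i′ ≡ k′
  Q-≡ r s = mk⇔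
    (λ e → ≤-antisym (to (Q-≤ r s) (≤-reflexive e)) (to (Q-≤ s r) (≤-reflexive (sym e))))
    (λ e → ≤-antisym (from (Q-≤ r s) (≤-reflexive e)) (from (Q-≤ s r) (≤-reflexive (sym e))))

  Q-⊴ : Q i i′ → Q k k′ → (i , j) ⊴ (k , l) ⇔ (i′ , j) ⊴ (k′ , l)
  Q-⊴ r s = (Q-≡ r s ×-⇔ mk⇔ id id) ⊎-⇔ (Q-≤ r s ×-⇔ mk⇔ id id)

  Q-Upto : Q i i′ → Pointwise Q I I′ → Upto I J i j ⇔ Upto I′ J i′ j
  Q-Upto r nothing  = mk⇔ (λ { (_ , inj₁ e) → tt , inj₁ e }) (λ { (_ , inj₁ e) → tt , inj₁ e })
  Q-Upto r (just s) = Q-≤ r s ×-⇔ (mk⇔ id id ⊎-⇔ (just-⇔ ×-⇔ mk⇔ id id))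
    where
    just-⇔ = mk⇔ (λ { refl → cong just (to (Q-≡ s r) refl) })
                 (λ { refl → cong just (from (Q-≡ s r) refl) })

  ≼-preserved : ∀ {σ σ′ τ τ′} → Cells Q σ σ′ → Cells Q τ τ′ → σ ≼ τ ⇔ σ′ ≼ τ′
  ≼-preserved (cells {i} {i′} j r) (cells {k} {k′} l s) = mk⇔
    (λ p → ⊴⇒≼ i′ j k′ l (to (Q-⊴ r s) (≼⇒⊴ i k p)))
    (λ p → ⊴⇒≼ i j k l (from (Q-⊴ r s) (≼⇒⊴ i′ k′ p)))

  ∈-preserved : ∀ {τ τ′ S S′} → Cells Q τ τ′ → Paths Q S S′ → τ ∈ nodes S ⇔ τ′ ∈ nodes S′
  ∈-preserved (cells {k} {k′} l t) (paths {i} {i′} {j} {I} {I′} {J} r r∞ s s′) = mk⇔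
    (λ p → let q , u = to (Shape.cell∈ s k l) p in
           from (Shape.cell∈ s′ k′ l) (to (Q-⊴ r t) q , to (Q-Upto {J = J} t r∞) u))
    (λ p → let q , u = to (Shape.cell∈ s′ k′ l) p in
           from (Shape.cell∈ s k l) (from (Q-⊴ r t) q , from (Q-Upto {J = J} t r∞) u))

  lab-preserved : ∀ {n n′ τ τ′} → Q n n′ → Cells Q τ τ′ →
                  ∀ b → b ∈ combLab n τ ⇔ b ∈ combLab n′ τ′
  lab-preserved r (cells {i} {i′} j s) true = mk⇔ (tooth i i′) (tooth i′ i)
    where
    tooth : ∀ i i′ → ∃[ k ] ∃[ l ] cell i j ≡ cell k (suc l) →
                     ∃[ k ] ∃[ l ] cell i′ j ≡ cell k (suc l)
    tooth i i′ (k , l , e) with refl ← proj₂ (cell-injective i k e) = i′ , l , refl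
  lab-preserved {n} {n′} r (cells {i} {i′} j s) false = mk⇔
    (λ e → spine (to (Q-≡ s r)) (cell-injective i n e))
    (λ e → spine (from (Q-≡ s r)) (cell-injective i′ n′ e))
    where
    spine : ∀ {i n i′ n′} → (i ≡ n → i′ ≡ n′) → i ≡ n × j ≡ 0 → cell i′ j ≡ cell n′ 0
    spine f (e , refl) = cong (λ i → cell i 0) (f e)

-- Induction on MPL formulas

margin : Monadic Bool m n → ℕ
margin (lab[ _ ] _) = 1
margin (_ ≤′ _)     = 1
margin (_ ∈′ _)     = 1
margin (¬′ φ)       = margin φ
margin (φ ∧′ χ)     = margin φ + margin χ
-- A new node may force the centre to move by the margin of `φ`, so twice that much is needed
-- beforehand.
margin (∃¹ φ)       = margin φ + margin φ
-- A path is chosen in two moves, its root and its end.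
margin (∃² φ)       = (margin φ + margin φ) + (margin φ + margin φ)

1≤margin : (φ : Monadic Bool m n) → 1 ≤ margin φ
1≤margin (lab[ _ ] _) = ≤-refl
1≤margin (_ ≤′ _)     = ≤-refl
1≤margin (_ ∈′ _)     = ≤-refl
1≤margin (¬′ φ)       = 1≤margin φ
1≤margin (φ ∧′ χ)     = ≤-trans (1≤margin φ) (m≤m+n _ _)
1≤margin (∃¹ φ)       = ≤-trans (1≤margin φ) (m≤m+n _ _)
1≤margin (∃² φ)       = ≤-trans (1≤margin φ) (≤-trans (m≤m+n _ _) (m≤m+n _ _))

-- The invariant of the game. Treating the marked positions as a chosen pair makes the labels agree.
record Related (d c n n′ : ℕ) {m k} (ρ ρ′ : Vec Word m) (σ σ′ : Vec Tree k) : Set where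
  field
    d≤c    : d ≤ c
    marks  : Shift d c n n′
    nodes~ : ∀ x → Cells (Shift d c) (lookup ρ x) (lookup ρ′ x)
    trees~ : ∀ s → Paths (Shift d c) (lookup σ s) (lookup σ′ s)

module _ {n n′ m k : ℕ} {ρ ρ′ : Vec Word m} {σ σ′ : Vec Tree k} where

  Related-map : ∀ {d c d′ c′} → d′ ≤ c′ → (∀ {x y} → Shift d c x y → Shift d′ c′ x y) →
                Related d c n n′ ρ ρ′ σ σ′ → Related d′ c′ n n′ ρ ρ′ σ σ′
  Related-map d′≤c′ f r = record
    { d≤c    = d′≤c′
    ; marks  = f marks
    ; nodes~ = λ x → Cells-map f (nodes~ x)
    ; trees~ = λ s → Paths-map f (trees~ s)
    }
    where
    open Related r

  Related-weaken : ∀ {d e c} → d ≤ e → Related e c n n′ ρ ρ′ σ σ′ → Related d c n n′ ρ ρ′ σ σ′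
  Related-weaken d≤e r = Related-map (≤-trans d≤e (Related.d≤c r)) (Shift-weaken d≤e) r

  Related-node : ∀ {d c τ τ′} → Cells (Shift d c) τ τ′ → Related d c n n′ ρ ρ′ σ σ′ →
                 Related d c n n′ (τ ∷ ρ) (τ′ ∷ ρ′) σ σ′
  Related-node t r = record { Related r ; nodes~ = λ { zero → t ; (suc x) → Related.nodes~ r x } }

  Related-tree : ∀ {d c S S′} → Paths (Shift d c) S S′ → Related d c n n′ ρ ρ′ σ σ′ →
                 Related d c n n′ ρ ρ′ (S ∷ σ) (S′ ∷ σ′)
  Related-tree t r = record { Related r ; trees~ = λ { zero → t ; (suc x) → Related.trees~ r x } }

Lift-⇔ : {P Q : Set} → P ⇔ Q → Lift (lsuc 0ℓ) P ⇔ Lift (lsuc 0ℓ) Q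
Lift-⇔ e = mk⇔ (λ (lift p) → lift (to e p)) (λ (lift q) → lift (from e q))

module _ (em : ExcludedMiddle (lsuc 0ℓ)) (n n′ : ℕ) where

  private
    module L = MonadicSemantics IsPath (𝒞 n)
    module L′ = MonadicSemantics IsPath (𝒞 n′)

  -- Quantifiers are answered by `forth` and `back`, whose new centre preserves `Related` at the
  -- margin of the body. Atomic formulas have margin 1, which makes `Shift` an order embedding.
  indistinguishable : ∀ {m k} (φ : Monadic Bool m k) {c ρ ρ′ σ σ′} →
    Related (margin φ) c n n′ ρ ρ′ σ σ′ → L.⟦ φ ⟧ ρ σ ⇔ L′.⟦ φ ⟧ ρ′ σ′
  indistinguishable (lab[ b ] x) r = Lift-⇔ (lab-preserved marks (nodes~ x) b)
    where
    open Related r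
    open OrderEmbedding (Shift-≤ ≤-refl)
  indistinguishable (x ≤′ y) r = Lift-⇔ (≼-preserved (nodes~ x) (nodes~ y))
    where
    open Related r
    open OrderEmbedding (Shift-≤ ≤-refl)
  indistinguishable (x ∈′ s) r = Lift-⇔ (∈-preserved (nodes~ x) (trees~ s))
    where
    open Related r
    open OrderEmbedding (Shift-≤ ≤-refl)
  indistinguishable (¬′ φ) r = ¬-cong-⇔ (indistinguishable φ r)
  indistinguishable (φ ∧′ χ) r =
    indistinguishable φ (Related-weaken (m≤m+n _ _) r) ×-⇔
    indistinguishable χ (Related-weaken (m≤n+m _ (margin φ)) r)
  indistinguishable (∃¹ φ) {c} {ρ} {ρ′} {σ} {σ′} r = mk⇔
    (λ { (_ , (i , j , refl , _) , p) → let i′ , v = forth 2d≤c i in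
         cell i′ j , cell∈comb i′ j , to (indistinguishable φ (step j v)) p })
    (λ { (_ , (i′ , j , refl , _) , p) → let i , v = back 2d≤c i′ in
         cell i j , cell∈comb i j , from (indistinguishable φ (step j v)) p })
    where
    2d≤c = Related.d≤c r

    step : ∀ {i i′} j (v : Move (margin φ) c i i′) →
           Related (margin φ) (Move.centre v) n n′ (cell i j ∷ ρ) (cell i′ j ∷ ρ′) σ σ′
    step j v = Related-node (cells j related) (Related-map d≤ extends r)
      where
      open Move v
  indistinguishable (∃² φ) {c} {ρ} {ρ′} {σ} {σ′} r = mk⇔ fwd bwd
    where
    d = margin φ
    4d≤c = Related.d≤c r

    -- The move `v` places the root and leaves margin `d + d`; the move `w` places the end and
    -- leaves margin `d`. The second must also carry the pair of roots along.
    module Step {i i′ : ℕ} (v : Move (d + d) c i i′)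
                {I I′ : Maybe ℕ} (w : Move∞ d (Move.centre v) I I′) where
      open Move∞ w

      r₁ : Shift d centre i i′
      r₁ = extends (Move.related v)

      open OrderEmbedding (Shift-≤ {d} {centre} (1≤margin φ))

      upto : ∀ {j J} → Upto I J i j ⇔ Upto I′ J i′ j
      upto {J = J} = Q-Upto {J = J} r₁ related

      ih : ∀ {S S′ j J} → Shape S i j I J → Shape S′ i′ j I′ J →
           L.⟦ φ ⟧ ρ (S ∷ σ) ⇔ L′.⟦ φ ⟧ ρ′ (S′ ∷ σ′)
      ih s s′ = indistinguishable φ (Related-tree (paths r₁ related s s′)
        (Related-map d≤ (extends ∘ Move.extends v) r))

    fwd : L.⟦ ∃² φ ⟧ ρ σ → L′.⟦ ∃² φ ⟧ ρ′ σ′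
    fwd (S , S⊑ , path , p) =
      let i , j , I , J , s = path-shape em S S⊑ path
          i′ , v = forth 4d≤c i
          I′ , w = forth∞ (Move.d≤ v) I
          u = to (Step.upto v w {J = J}) (Shape.start s)
      -- The answering path copies both heights `j` and `J`; only its spine indices come from the
      -- moves.
      in pathcomb I′ J i′ j u , pathcomb⊑comb I′ J i′ j u , pathcomb-isPath {I′} {J} {i′} {j} {u} ,
         to (Step.ih v w s pathcomb-shape) p

    bwd : L′.⟦ ∃² φ ⟧ ρ′ σ′ → L.⟦ ∃² φ ⟧ ρ σ
    bwd (S , S⊑ , path , p) =
      let i′ , j , I′ , J , s = path-shape em S S⊑ path
          i , v = back 4d≤c i′
          I , w = back∞ (Move.d≤ v) I′
          u = from (Step.upto v w {J = J}) (Shape.start s)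
      in pathcomb I J i j u , pathcomb⊑comb I J i j u , pathcomb-isPath {I} {J} {i} {j} {u} ,
         from (Step.ih v w pathcomb-shape s) p

-- Parity in STL*

Even : ℕ → Set
Even zero    = ⊤
Even (suc n) = ¬ Even n

even? : ∀ n → Dec (Even n)
even? zero    = yes tt
even? (suc n) = ¬? (even? n)

even-double : ∀ n → Even (n + n)
even-double zero    = tt
even-double (suc n) = subst Even (cong suc (sym (+-suc n n))) (λ ¬e → ¬e (even-double n))

⊥ˢ ⊤ˢ hasTooth evenMark : StateF Bool
⊥ˢ = atom tail ∧ˢ (¬ˢ atom tail)
⊤ˢ = ¬ˢ ⊥ˢ
hasTooth = E (X (state (atom tail)))

alternating : PathF Bool
alternating = (state hasTooth ∧ᵖ X (state (¬ˢ hasTooth)))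
           ∨ᵖ (state (¬ˢ hasTooth) ∧ᵖ X (state hasTooth))

-- The index `⊥ˢ` constrains no children and `⊤ˢ` no intermediate trees, so the `𝕌` just asks for
-- some strict subtree, that is, for a choice of teeth to keep. A path must then alternate from a
-- toothed root to a toothed mark.
evenMark = ⊤ˢ 𝕌[ ⊥ˢ ] E (state hasTooth ∧ᵖ (alternating U state (atom mark ∧ˢ hasTooth)))

module _ (n : ℕ) where
  open STLSemantics (combLab n)

  Toothed : (T : NBTree) → T ⊑ʳ comb → InfPath T → ℕ → Set₁
  Toothed T s π k = holds comb T s π k (state hasTooth)

  alternation : (t : ℕ → Set₁) → t 0 → ∀ j →
    (∀ k → k < j → (t k × ¬ t (suc k)) ⊎ (¬ t k × t (suc k))) → t j ⇔ Even j
  alternation t t₀ zero    alt = mk⇔ (λ _ → tt) (λ _ → t₀)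
  alternation t t₀ (suc j) alt
    with alternation t t₀ j (λ k k<j → alt k (m<n⇒m<1+n k<j)) | alt j ≤-refl
  ... | e | inj₁ (tj , ¬tj′) =
    mk⇔ (λ tj′ → contradiction tj′ ¬tj′) (λ ¬even → contradiction (to e tj) ¬even)
  ... | e | inj₂ (¬tj , tj′) = mk⇔ (λ _ even → ¬tj (from e even)) (λ _ → tj′)

  -- The path meets the mark at position `n`, because its root is the empty word and the mark has
  -- length `n`. From a toothed root, alternation puts teeth exactly at the even positions up to
  -- there.
  evenMark-sound : Sat STL* (𝒞 n) evenMark → Even n
  evenMark-sound (T , s , _ , (π , t₀ , j , _ , (lift marked , tj) , alt) , _) =
    subst Even j≡n (to (alternation (Toothed T s π) t₀ j (λ k → alt k z≤n)) tj)
    where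
    j≡n : j ≡ n
    j≡n = trans (sym (trans (pos-length π j) (cong (λ r → length r + j) (proj₁ s))))
      (trans (cong length marked) (trans (length-cell n 0) (+-identityʳ n)))

  private
    Kept : ℕ → ℕ → Set
    Kept i j = j ≡ 0 ⊎ Even i

    Kept-closed : (i , j) ⊴ (k , l) → Kept k l → Kept i j
    Kept-closed (inj₁ (refl , z≤n)) (inj₁ refl) = inj₁ refl
    Kept-closed (inj₁ (refl , _))   (inj₂ e)    = inj₂ e
    Kept-closed (inj₂ (_ , refl))   _           = inj₁ refl

  evenComb : NBTree
  evenComb = record
    { tree        = subcomb Kept Kept-closed 0 0 (inj₁ refl)
    ; nonBlocking = subcomb-nonBlocking Kept Kept-closed 0 0 (inj₁ refl) λ where
        _ (inj₁ refl) → inj₂ (refl , inj₁ refl)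
        _ (inj₂ e)    → inj₁ (inj₂ e)
    }

  evenComb⊑ʳ : evenComb ⊑ʳ comb
  evenComb⊑ʳ = refl , subcomb⊑comb Kept Kept-closed 0 0 (inj₁ refl)

  cell∈evenComb : ∀ i j → cell i j ∈ nodes (tree evenComb) ⇔ Kept i j
  cell∈evenComb i j = mk⇔ (proj₂ ∘ to e) (λ q → from e (inj₂ (z≤n , refl) , q))
    where e = cell∈subcomb Kept Kept-closed 0 0 (inj₁ refl) {i} {j}

  spine : InfPath evenComb
  spine = record
    { path   = record
      { tree        = S
      ; nonBlocking = subcomb-nonBlocking (Upto nothing (just 0)) Upto-closed 0 0 (tt , inj₁ refl)
                        λ { _ (_ , inj₁ refl) → inj₂ (refl , tt , inj₁ refl) }
      }
    ; isPath = pathcomb-isPath {nothing} {just 0} {0} {0} {tt , inj₁ refl}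
    ; within = refl , λ { (k , l , refl , _ , _ , inj₁ refl) →
                          from (cell∈evenComb k 0) (inj₁ refl) }
    }
    where S = pathcomb nothing (just 0) 0 0 (tt , inj₁ refl)

  -- A node of the spine is determined by its length, which is also its position.
  pos-spine : ∀ k → pos spine k ≡ cell k 0
  pos-spine k with proj₂ (InfPath.node spine k)
  ... | i , _ , eq , _ , _ , inj₁ refl = trans eq (cong (λ i → cell i 0) (sym k≡i))
    where
    k≡i : k ≡ i
    k≡i = trans (sym (pos-length spine k))
      (trans (cong length eq) (trans (length-cell i 0) (+-identityʳ i)))

  first-tooth : ∀ k c i l → cell k 0 ∷ʳ c ≡ cell i (suc l) → k ≡ i
  first-tooth k c i l eq = proj₁ (cell-injective k i
    (proj₁ (∷ʳ-injective (cell k 0) (cell i l) (trans eq (sym (cell-tooth i l))))))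

  toothed⇒even : ∀ k → Toothed evenComb evenComb⊑ʳ spine k → Even k
  toothed⇒even k (π , lift (i , l , eq)) =
    subst Even (sym k≡i) (even (to (cell∈evenComb i (suc l)) tooth∈))
    where
    tooth∈ : cell i (suc l) ∈ nodes (tree evenComb)
    tooth∈ = subst (nodes (tree evenComb)) eq (proj₁ (InfPath.node∈ π 1))

    c : ℕ
    c = proj₁ (nonBlocking (InfPath.path π) (proj₂ (InfPath.node π 0)))

    k≡i : k ≡ i
    k≡i = first-tooth k c i l (trans (cong (_∷ʳ c)
      (sym (trans (proj₁ (InfPath.within π)) (pos-spine k)))) eq)

    even : Kept i (suc l) → Even i
    even (inj₂ e) = e

  -- The witnessing path starts at spine node `k` and climbs its tooth, which is kept since `k` is
  -- even.
  even⇒toothed : ∀ k → Even k → Toothed evenComb evenComb⊑ʳ spine k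
  even⇒toothed k e = π , lift tooth
    where
    start : Upto (just k) nothing k 0
    start = ≤-refl , inj₁ refl

    on-tooth : ∀ {i j} → (k , 0) ⊴ (i , j) → i ≤ k → k ≡ i
    on-tooth (inj₁ (k≡i , _)) _   = k≡i
    on-tooth (inj₂ (k≤i , _)) i≤k = ≤-antisym k≤i i≤k

    π : InfPath (evenComb at InfPath.node∈ spine k)
    π = record
      { path   = record
        { tree        = pathcomb (just k) nothing k 0 start
        ; nonBlocking = subcomb-nonBlocking (Upto (just k) nothing) (Upto-closed {I = just k})
            k 0 start λ p (i≤k , _) → inj₁ (i≤k , inj₂ (cong just (on-tooth p i≤k) , tt))
        }
      ; isPath = pathcomb-isPath {just k} {nothing} {k} {0} {start}
      ; within = sym (pos-spine k) , within
      }
      where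
      within : pathcomb (just k) nothing k 0 start ⊑ tree (evenComb at InfPath.node∈ spine k)
      within (i , j , refl , p , i≤k , _) =
        from (cell∈evenComb i j) (inj₂ (subst Even (on-tooth p i≤k) e)) ,
        subst (_≼ cell i j) (sym (pos-spine k)) (⊴⇒≼ k 0 i j p)

    tooth : ∃[ i ] ∃[ j ] pos π 1 ≡ cell i (suc j)
    tooth with proj₂ (InfPath.node π 1)
    ... | i , suc j , eq , _ = i , j , eq
    -- A spine node at position 1 would have index `suc k`, but the spine indices on this path are
    -- at most `k`.
    ... | i , zero , eq , _ , i≤k , _ = contradiction (≤-reflexive 1+k≡i) (<⇒≱ (s≤s i≤k))
      where
      1+k≡i : suc k ≡ i
      1+k≡i = trans (+-comm 1 k) (trans (sym (trans (pos-length π 1) (cong (_+ 1)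
        (trans (cong length (pos-spine k)) (trans (length-cell k 0) (+-identityʳ k))))))
        (trans (cong length eq) (trans (length-cell i 0) (+-identityʳ i))))

  evenMark-complete : Even n → Sat STL* (𝒞 n) evenMark
  evenMark-complete even-n =
    evenComb , evenComb⊑ʳ
    -- The closure condition is vacuous, as no node satisfies `⊥ˢ`.
    , (evenComb⊑ʳ , strict , λ (_ , t , ¬t) → contradiction t ¬t)
    , (spine , even⇒toothed 0 tt , n , z≤n
      , (lift (pos-spine n) , even⇒toothed n even-n)
      , λ k _ _ → alternate k)
    , λ _ _ _ _ (t , ¬t) → ¬t t
    where
    strict : ¬ (tree comb ⊑ tree evenComb)
    strict comb⊑ with to (cell∈evenComb 1 1) (comb⊑ (cell∈comb 1 1))
    ... | inj₂ ¬e = ¬e tt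

    alternate : ∀ k → holds comb evenComb evenComb⊑ʳ spine k alternating
    alternate k with even? k
    ... | yes e = inj₁ (even⇒toothed k e , λ t → toothed⇒even (suc k) t e)
    ... | no ¬e = inj₂ ((λ t → ¬e (toothed⇒even k t)) , even⇒toothed (suc k) ¬e)

-- MPL cannot express the parity of the mark

STL*≰MPL : ExcludedMiddle (lsuc 0ℓ) → STL* ≰ᴸ MPL
STL*≰MPL em STL*≤MPL = evenMark-sound (suc 2d) (from (equivalent (𝒞 (suc 2d))) (to same
    (to (equivalent (𝒞 2d)) (evenMark-complete 2d (even-double d))))) (even-double d)
  where
  expressed  = STL*≤MPL Bool (2 , ↔-sym 2↔Bool) evenMark
  φ          = proj₁ expressed
  equivalent = proj₂ expressed
  -- With centre `d`, the mark `2d` is exactly `d` above the centre, so the shift takes it to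
  -- `suc 2d`; doubling also makes the first mark even and the second odd.
  d  = margin φ
  2d = d + d

  same : Sat MPL (𝒞 2d) φ ⇔ Sat MPL (𝒞 (suc 2d)) φ
  same = indistinguishable em 2d (suc 2d) φ {c = d} record
    { d≤c    = ≤-refl
    ; marks  = inj₂ (≤-refl , refl)
    ; nodes~ = λ ()
    ; trees~ = λ ()
    }

theorem14 : ExcludedMiddle (lsuc 0ℓ) → (STL* ≤ᴸ MTL) × (STL* ≰ᴸ MPL)
theorem14 em = STL*≤MTL em , STL*≰MPL em
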